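{- Let $n\ge 1$ and $d\ge 0$ be integers. Let $G=(V,E)$ be a non-empty induced subgraph of the hypercube $Q_n$ such that (1) $G$ is irreducible and (2) the minimum degree of $G$ is $\delta(G)=d$. Then the smallest possible cardinality of $V$ is $$|V|=\left\lceil 2^{d+1}-2^{2d-n}\right\rceil,$$ i.e. every such $G$ satisfies $|V|\ge \lceil 2^{d+1}-2^{2d-n}\rceil$, and (whenever such subgraphs exist for the given $n,d$) this value is attained by some such $G$.
   Context: $Q_n$ is the graph with vertex set $\{0,1\}^n$ in which two vertices are adjacent iff they differ in exactly one coordinate. Subgraphs of $Q_n$ are considered as the subgraphs induced by their vertex sets. An $m$-dimensional subcube of $Q_n$ is the induced subgraph on the set of all vertices having prescribed bit values at $n-m$ fixed distinct positions. A subgraph $G\subseteq Q_n$ is reducible if it is contained in some subgraph whose vertex set is obtained by fixing one or more of the coordinates $x_i$ to given values; otherwise it is irreducible. Equivalently, $G$ is irreducible iff every $(n-1)$-dimensional subcube of $Q_n$ (obtained by fixing a single coordinate $x_i=j$) contains at least one vertex of $G$. -}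

module Defs where

open import Data.Bool using (Bool; true; false; not; if_then_else_)
open import Data.Nat using (ℕ; zero; suc; _^_; _*_; _≤_; NonZero)
open import Data.Nat.Properties using (m^n≢0)
open import Data.Integer using (ℤ; +_)
open import Data.Rational using (ℚ; _/_; _-_; ceiling)
open import Data.Fin using (Fin)
open import Data.Vec using (Vec; []; _∷_; lookup; _[_]%=_)
open import Data.List using (List; []; _∷_; map; _++_; allFin)
open import Data.Product using (Σ; _×_; ∃)
open import Relation.Binary.PropositionalEquality using (_≡_)

Vertex : ℕ → Set
Vertex n = Vec Bool n

-- An induced subgraph of Q_n is given by its vertex set, a (decidable) subset of {0,1}^n.
VertexSet : ℕ → Set
VertexSet n = Vertex n → Bool

allVertices : (n : ℕ) → List (Vertex n)
allVertices zero = [] ∷ []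
allVertices (suc n) = map (false ∷_) (allVertices n) ++ map (true ∷_) (allVertices n)

count : {A : Set} → (A → Bool) → List A → ℕ
count p [] = 0
count p (x ∷ xs) = if p x then suc (count p xs) else count p xs

card : {n : ℕ} → VertexSet n → ℕ
card {n} S = count S (allVertices n)

flipAt : {n : ℕ} → Vertex n → Fin n → Vertex n
flipAt v i = v [ i ]%= not

degree : {n : ℕ} → VertexSet n → Vertex n → ℕ
degree {n} S v = count (λ i → S (flipAt v i)) (allFin n)

-- Minimum degree of G equals d (G is then automatically non-empty).
MinDegree : {n : ℕ} → VertexSet n → ℕ → Set
MinDegree S d =
  ((v : Vertex _) → S v ≡ true → d ≤ degree S v)
  × (∃ λ v → S v ≡ true × degree S v ≡ d)

NonEmpty : {n : ℕ} → VertexSet n → Set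
NonEmpty S = ∃ λ v → S v ≡ true

Irreducible : {n : ℕ} → VertexSet n → Set
Irreducible {n} S = (i : Fin n) (b : Bool) → ∃ λ v → S v ≡ true × lookup v i ≡ b

Admissible : (n d : ℕ) → VertexSet n → Set
Admissible n d S = NonEmpty S × Irreducible S × MinDegree S d

-- ⌈ 2^(d+1) - 2^(2d-n) ⌉ computed in ℚ, with 2^(2d-n) = 2^(2d) / 2^n.
bound : (n d : ℕ) → ℤ
bound n d = ceiling ((+ (2 ^ suc d)) / 1 - _/_ (+ (2 ^ (2 * d))) (2 ^ n) {{m^n≢0 2 n}})

{-# OPTIONS --safe #-}

-- For v in S let sens v = n - degree v be the number of neighbours of v outside S, and put k = n - d,
-- so that sens ≤ k on S; the bound says that the density |S| / 2^n is at least 1 - (1 - 2^-k)^2.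
-- Simon's lemma, Σ_{v ∈ S} 2^(sens v) ≥ 2^n for S non-empty, gives density at least 2^-k.
--
-- If S meets all intersections of the two faces of the first coordinate with every other face, both
-- halves are irreducible and induction on n applies.  Otherwise S avoids {x_i = b, x_j = c} for some
-- i ≠ j.  Choose such a pair with the faces x_i = b and x_j = c of S as small as possible.  Either two
-- literals are equivalent on S, and S falls into two parts with no edges between them, each of density
-- at least 2^-k; or the opposite faces x_i = not b and x_j = not c are irreducible.  In the latter case
-- let A, M, B be the three remaining quadrants, with M adjacent to A and to B, seen as subsets of one
-- cube.  A ∪ M and B ∪ M are irreducible with sens ≤ k - 1, to which induction on k applies, and
-- Simon's lemma bounds |A| + |A ∩ M| and |B| + |B ∩ M|; the sum of the four bounds is the claim, since
-- |A ∪ M| + |B ∪ M| + |A| + |A ∩ M| + |B| + |B ∩ M| = 2 (|A| + |M| + |B|).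
--
-- Equality holds for the union of two d-dimensional subcubes, one fixing k coordinates to 0, the other
-- k coordinates to 1, with the two sets of coordinates overlapping as little as possible.

module Submission where

open import Defs
open import Data.Bool using (Bool; true; false; not; _∧_; _∨_; _≟_)
open import Data.Bool.Properties using (not-involutive; ¬-not; not-¬; ∨-zeroʳ; ∧-zeroʳ)
open import Data.Empty using (⊥; ⊥-elim)
open import Data.Fin using (Fin; zero; suc)
import Data.Fin.Properties as Fin
open import Data.Integer as ℤ using (ℤ; +_; -[1+_]; +[1+_])
open import Data.Integer.DivMod using ([n/ℕd]*d≤n; n<s[n/ℕd]*d; div-pos-is-/ℕ; _/ℕ_)
import Data.Integer.Properties as ℤ
import Data.Integer.Tactic.RingSolver as ℤ-Solver
import Data.List as List
open import Data.List using (List; []; _∷_)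
open import Data.Nat using (ℕ; zero; suc; _+_; _*_; _^_; _∸_; _≤_; _<_; _≥_; z≤n; s≤s; s≤s⁻¹; NonZero; >-nonZero⁻¹)
open import Data.Nat.Properties hiding (_≟_)
open import Data.Nat.Tactic.RingSolver using (solve-∀)
open import Data.Product using (_×_; _,_; ∃; ∃₂; proj₁; proj₂)
open import Data.Rational as ℚ using (ℚ; mkℚ; ceiling; ↥_; ↧_; ↧ₙ_)
import Data.Rational.Properties as ℚ
open import Data.Rational.Unnormalised as ℚᵘ using (mkℚᵘ; _≃_)
import Data.Rational.Unnormalised.Properties as ℚᵘ
open import Data.Sum using (_⊎_; inj₁; inj₂; [_,_]′)
open import Data.Vec using (Vec; []; _∷_; _++_; lookup; replicate; updateAt; _[_]≔_)
open import Data.Vec.Properties using (lookup-replicate; lookup∘updateAt; lookup∘updateAt′; lookup∘update; lookup∘update′; []≔-lookup; updateAt-updateAt; updateAt-commutes)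
open import Function using (_∘_)
open import Relation.Binary.PropositionalEquality
open import Relation.Nullary using (Dec; yes; no; does; ¬_; ¬?; contradiction; _×-dec_; _⊎-dec_; map′)
open import Relation.Nullary.Decidable using (decidable-stable; dec-true)

-- Sums over coordinates and over vertices

𝟙 : Bool → ℕ
𝟙 true = 1
𝟙 false = 0

∑ᶜ : ∀ {n} → (Fin n → ℕ) → ℕ
∑ᶜ {zero} f = 0
∑ᶜ {suc n} f = f zero + ∑ᶜ (f ∘ suc)

∑ᶜ-mono : ∀ {n} {f g : Fin n → ℕ} → (∀ i → f i ≤ g i) → ∑ᶜ f ≤ ∑ᶜ g
∑ᶜ-mono {zero} f≤g = z≤n
∑ᶜ-mono {suc n} f≤g = +-mono-≤ (f≤g zero) (∑ᶜ-mono (f≤g ∘ suc))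

∑ᶜ-extract₁ : ∀ {n} (i : Fin n) {f g : Fin n → ℕ} {a : ℕ} → f i ≡ 0 → a ≤ g i →
  (∀ l → l ≢ i → f l ≤ g l) → ∑ᶜ f + a ≤ ∑ᶜ g
∑ᶜ-extract₁ zero {f} {g} {a} fi≡0 a≤gi f≤g rewrite fi≡0 = begin
  ∑ᶜ (f ∘ suc) + a        ≡⟨ +-comm _ a ⟩
  a + ∑ᶜ (f ∘ suc)        ≤⟨ +-mono-≤ a≤gi (∑ᶜ-mono (λ l → f≤g (suc l) λ ())) ⟩
  g zero + ∑ᶜ (g ∘ suc)   ∎
  where open ≤-Reasoning
∑ᶜ-extract₁ (suc i) {f} {g} {a} fi≡0 a≤gi f≤g = begin
  f zero + ∑ᶜ (f ∘ suc) + a     ≡⟨ +-assoc (f zero) _ a ⟩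
  f zero + (∑ᶜ (f ∘ suc) + a)   ≤⟨ +-mono-≤ (f≤g zero λ ()) (∑ᶜ-extract₁ i fi≡0 a≤gi λ l l≢i → f≤g (suc l) (l≢i ∘ suc-inj)) ⟩
  g zero + ∑ᶜ (g ∘ suc)         ∎
  where
  open ≤-Reasoning
  suc-inj : ∀ {l} → Fin.suc l ≡ suc i → l ≡ i
  suc-inj refl = refl

-- Meant for `f` the sensitivity count of a quadrant, which vanishes in the directions `i` and `j`
-- that the quadrant ignores, and `g` that of the whole set, which sees the neighbouring quadrants
-- there.
∑ᶜ-extract₂ : ∀ {n} (i j : Fin n) {f g : Fin n → ℕ} {a b : ℕ} → i ≢ j →
  f i ≡ 0 → f j ≡ 0 → a ≤ g i → b ≤ g j →
  (∀ l → l ≢ i → l ≢ j → f l ≤ g l) → ∑ᶜ f + a + b ≤ ∑ᶜ g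
∑ᶜ-extract₂ zero zero i≢j = contradiction refl i≢j
∑ᶜ-extract₂ zero (suc j) {f} {g} {a} {b} i≢j fi fj a≤ b≤ f≤g rewrite fi = begin
  ∑ᶜ (f ∘ suc) + a + b       ≡⟨ shuffle (∑ᶜ (f ∘ suc)) a b ⟩
  a + (∑ᶜ (f ∘ suc) + b)     ≤⟨ +-mono-≤ a≤ (∑ᶜ-extract₁ j fj b≤ λ l l≢j → f≤g (suc l) (λ ()) (λ { refl → l≢j refl })) ⟩
  g zero + ∑ᶜ (g ∘ suc)      ∎
  where
  open ≤-Reasoning
  shuffle : ∀ x a b → x + a + b ≡ a + (x + b)
  shuffle = solve-∀
∑ᶜ-extract₂ (suc i) zero {f} {g} {a} {b} i≢j fi fj a≤ b≤ f≤g rewrite fj = begin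
  ∑ᶜ (f ∘ suc) + a + b       ≡⟨ +-comm _ b ⟩
  b + (∑ᶜ (f ∘ suc) + a)     ≤⟨ +-mono-≤ b≤ (∑ᶜ-extract₁ i fi a≤ λ l l≢i → f≤g (suc l) (λ { refl → l≢i refl }) (λ ())) ⟩
  g zero + ∑ᶜ (g ∘ suc)      ∎
  where open ≤-Reasoning
∑ᶜ-extract₂ (suc i) (suc j) {f} {g} {a} {b} i≢j fi fj a≤ b≤ f≤g = begin
  f zero + ∑ᶜ (f ∘ suc) + a + b     ≡⟨ shuffle (f zero) (∑ᶜ (f ∘ suc)) a b ⟩
  f zero + (∑ᶜ (f ∘ suc) + a + b)   ≤⟨ +-mono-≤ (f≤g zero (λ ()) (λ ())) (∑ᶜ-extract₂ i j (i≢j ∘ cong suc) fi fj a≤ b≤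
                                         λ l l≢i l≢j → f≤g (suc l) (λ { refl → l≢i refl }) (λ { refl → l≢j refl })) ⟩
  g zero + ∑ᶜ (g ∘ suc)             ∎
  where
  open ≤-Reasoning
  shuffle : ∀ z x a b → z + x + a + b ≡ z + (x + a + b)
  shuffle = solve-∀

∑ᵛ : ∀ {n} → (Vertex n → ℕ) → ℕ
∑ᵛ {zero} f = f []
∑ᵛ {suc n} f = ∑ᵛ (f ∘ (false ∷_)) + ∑ᵛ (f ∘ (true ∷_))

∑ᵛ-cong : ∀ {n} {f g : Vertex n → ℕ} → (∀ v → f v ≡ g v) → ∑ᵛ f ≡ ∑ᵛ g
∑ᵛ-cong {zero} f≗g = f≗g []
∑ᵛ-cong {suc n} f≗g = cong₂ _+_ (∑ᵛ-cong (f≗g ∘ (false ∷_))) (∑ᵛ-cong (f≗g ∘ (true ∷_)))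

∑ᵛ-mono : ∀ {n} {f g : Vertex n → ℕ} → (∀ v → f v ≤ g v) → ∑ᵛ f ≤ ∑ᵛ g
∑ᵛ-mono {zero} f≤g = f≤g []
∑ᵛ-mono {suc n} f≤g = +-mono-≤ (∑ᵛ-mono (f≤g ∘ (false ∷_))) (∑ᵛ-mono (f≤g ∘ (true ∷_)))

∑ᵛ-mono-< : ∀ {n} {f g : Vertex n → ℕ} (v : Vertex n) → (∀ u → f u ≤ g u) → f v < g v → ∑ᵛ f < ∑ᵛ g
∑ᵛ-mono-< [] f≤g f<g = f<g
∑ᵛ-mono-< (false ∷ v) f≤g f<g = +-mono-<-≤ (∑ᵛ-mono-< v (f≤g ∘ (false ∷_)) f<g) (∑ᵛ-mono (f≤g ∘ (true ∷_)))
∑ᵛ-mono-< (true ∷ v) f≤g f<g = +-mono-≤-< (∑ᵛ-mono (f≤g ∘ (false ∷_))) (∑ᵛ-mono-< v (f≤g ∘ (true ∷_)) f<g)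

+-interchange : ∀ a b c d → (a + b) + (c + d) ≡ (a + c) + (b + d)
+-interchange = solve-∀

∑ᵛ-+ : ∀ {n} (f g : Vertex n → ℕ) → ∑ᵛ (λ v → f v + g v) ≡ ∑ᵛ f + ∑ᵛ g
∑ᵛ-+ {zero} f g = refl
∑ᵛ-+ {suc n} f g
  rewrite ∑ᵛ-+ (f ∘ (false ∷_)) (g ∘ (false ∷_)) | ∑ᵛ-+ (f ∘ (true ∷_)) (g ∘ (true ∷_))
  = +-interchange (∑ᵛ (f ∘ (false ∷_))) _ _ _

∑ᵛ-* : ∀ {n} (c : ℕ) (f : Vertex n → ℕ) → ∑ᵛ (λ v → c * f v) ≡ c * ∑ᵛ f
∑ᵛ-* {zero} c f = refl
∑ᵛ-* {suc n} c f rewrite ∑ᵛ-* c (f ∘ (false ∷_)) | ∑ᵛ-* c (f ∘ (true ∷_)) = sym (*-distribˡ-+ c _ _)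

∑ᵛ-zero : ∀ {n} → ∑ᵛ {n} (λ _ → 0) ≡ 0
∑ᵛ-zero {n} = ∑ᵛ-* {n} 0 (λ _ → 0)

-- Overwriting coordinate `i` by a fixed bit hits every vertex of that face exactly twice, and the
-- two faces partition the cube.
∑ᵛ-overwrite : ∀ {n} (i : Fin n) (b : Bool) (f : Vertex n → ℕ) →
  ∑ᵛ (λ v → f (v [ i ]≔ b)) + ∑ᵛ (λ v → f (v [ i ]≔ not b)) ≡ 2 * ∑ᵛ f
∑ᵛ-overwrite zero b f = both b
  where
  F = ∑ᵛ (f ∘ (false ∷_))
  T = ∑ᵛ (f ∘ (true ∷_))
  both₀ : ∀ x y → (x + x) + (y + y) ≡ 2 * (x + y)
  both₀ = solve-∀
  both₁ : ∀ x y → (y + y) + (x + x) ≡ 2 * (x + y)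
  both₁ = solve-∀
  both : ∀ b → (∑ᵛ (f ∘ (b ∷_)) + ∑ᵛ (f ∘ (b ∷_))) + (∑ᵛ (f ∘ (not b ∷_)) + ∑ᵛ (f ∘ (not b ∷_))) ≡ 2 * (F + T)
  both false = both₀ F T
  both true = both₁ F T
∑ᵛ-overwrite (suc i) b f = begin
  (F b + T b) + (F (not b) + T (not b))   ≡⟨ +-interchange (F b) (T b) (F (not b)) (T (not b)) ⟩
  (F b + F (not b)) + (T b + T (not b))   ≡⟨ cong₂ _+_ (∑ᵛ-overwrite i b (f ∘ (false ∷_))) (∑ᵛ-overwrite i b (f ∘ (true ∷_))) ⟩
  2 * ∑ᵛ (f ∘ (false ∷_)) + 2 * ∑ᵛ (f ∘ (true ∷_))  ≡⟨ *-distribˡ-+ 2 (∑ᵛ (f ∘ (false ∷_))) _ ⟨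
  2 * ∑ᵛ f ∎
  where
  open ≡-Reasoning
  F T : Bool → ℕ
  F b = ∑ᵛ (λ v → f (false ∷ v [ i ]≔ b))
  T b = ∑ᵛ (λ v → f (true ∷ v [ i ]≔ b))

size : ∀ {n} → VertexSet n → ℕ
size S = ∑ᵛ (𝟙 ∘ S)

count-++ : ∀ {A : Set} (p : A → Bool) (xs ys : List A) → count p (xs List.++ ys) ≡ count p xs + count p ys
count-++ p [] ys = refl
count-++ p (x ∷ xs) ys with p x
... | true = cong suc (count-++ p xs ys)
... | false = count-++ p xs ys

count-map : ∀ {A B : Set} (p : B → Bool) (f : A → B) (xs : List A) → count p (List.map f xs) ≡ count (p ∘ f) xs
count-map p f [] = refl
count-map p f (x ∷ xs) with p (f x)
... | true = cong suc (count-map p f xs)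
... | false = count-map p f xs

card≡size : ∀ {n} (S : VertexSet n) → card S ≡ size S
card≡size {zero} S with S []
... | true = refl
... | false = refl
card≡size {suc n} S = begin
  count S (List.map (false ∷_) (allVertices n) List.++ List.map (true ∷_) (allVertices n))
    ≡⟨ count-++ S (List.map (false ∷_) (allVertices n)) _ ⟩
  count S (List.map (false ∷_) (allVertices n)) + count S (List.map (true ∷_) (allVertices n))
    ≡⟨ cong₂ _+_ (count-map S (false ∷_) (allVertices n)) (count-map S (true ∷_) (allVertices n)) ⟩
  card (S ∘ (false ∷_)) + card (S ∘ (true ∷_))
    ≡⟨ cong₂ _+_ (card≡size (S ∘ (false ∷_))) (card≡size (S ∘ (true ∷_))) ⟩
  size S ∎
  where open ≡-Reasoning

-- Sensitivity

sens : ∀ {n} → VertexSet n → Vertex n → ℕ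
sens S v = ∑ᶜ (λ i → 𝟙 (not (S (flipAt v i))))

count+sens : ∀ {n} {A : Set} (p : A → Bool) (f : Fin n → A) → count p (List.tabulate f) + ∑ᶜ (λ i → 𝟙 (not (p (f i)))) ≡ n
count+sens {zero} p f = refl
count+sens {suc n} p f with p (f zero)
... | true = cong suc (count+sens p (f ∘ suc))
... | false = trans (+-suc _ _) (cong suc (count+sens p (f ∘ suc)))

degree+sens : ∀ {n} (S : VertexSet n) (v : Vertex n) → degree S v + sens S v ≡ n
degree+sens S v = count+sens (λ i → S (flipAt v i)) (λ i → i)

-- Only the neighbours of `v` are compared. This also covers a `T` smaller than `S` that keeps all
-- neighbours of `v` in `S`, such as a face.
sens-anti : ∀ {n} {S T : VertexSet n} (v : Vertex n) →
  (∀ i → S (flipAt v i) ≡ true → T (flipAt v i) ≡ true) → sens T v ≤ sens S v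
sens-anti {S = S} {T} v S⊆T = ∑ᶜ-mono λ i → compare (S (flipAt v i)) (T (flipAt v i)) (S⊆T i)
  where
  compare : ∀ s t → (s ≡ true → t ≡ true) → 𝟙 (not t) ≤ 𝟙 (not s)
  compare s true h = z≤n
  compare false false h = ≤-refl
  compare true false h with h refl
  ... | ()

∃ᵛ? : ∀ {n} {P : Vertex n → Set} → (∀ v → Dec (P v)) → Dec (∃ P)
∃ᵛ? {zero} P? = map′ ([] ,_) (λ { ([] , p) → p }) (P? [])
∃ᵛ? {suc n} P? = map′ [ (λ (v , p) → false ∷ v , p) , (λ (v , p) → true ∷ v , p) ]′
  (λ { (false ∷ v , p) → inj₁ (v , p) ; (true ∷ v , p) → inj₂ (v , p) })
  (∃ᵛ? (P? ∘ (false ∷_)) ⊎-dec ∃ᵛ? (P? ∘ (true ∷_)))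

nonEmpty? : ∀ {n} (S : VertexSet n) → Dec (NonEmpty S)
nonEmpty? S = ∃ᵛ? λ v → S v ≟ true

weight : ∀ {n} → VertexSet n → Vertex n → ℕ
weight S v = 𝟙 (S v) * 2 ^ sens S v

-- Simon's lemma.
2^n≤∑weight : ∀ {n} (S : VertexSet n) → NonEmpty S → 2 ^ n ≤ ∑ᵛ (weight S)
2^n≤∑weight {zero} S ([] , p) rewrite p = ≤-refl
2^n≤∑weight {suc n} S ne = go (nonEmpty? (half false)) (nonEmpty? (half true))
  where
  open ≤-Reasoning
  half : Bool → VertexSet n
  half b = S ∘ (b ∷_)
  grow : ∀ b → 2 ^ n ≤ ∑ᵛ (weight (half b)) → 2 ^ n ≤ ∑ᵛ (weight S ∘ (b ∷_))
  grow b h = ≤-trans h (∑ᵛ-mono λ v → *-monoʳ-≤ (𝟙 (S (b ∷ v))) (^-monoʳ-≤ 2 (m≤n+m (sens (half b) v) (𝟙 (not (S (not b ∷ v)))))))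
  -- With the opposite half empty, each vertex of this half gains exactly one neighbour outside `S`,
  -- so its weight doubles and makes up for the missing half.
  double : ∀ b → (∀ v → S (not b ∷ v) ≡ false) → 2 ^ n ≤ ∑ᵛ (weight (half b)) → 2 * 2 ^ n ≤ ∑ᵛ (weight S ∘ (b ∷_))
  double b empty h = begin
    2 * 2 ^ n                           ≤⟨ *-monoʳ-≤ 2 h ⟩
    2 * ∑ᵛ (weight (half b))            ≡⟨ ∑ᵛ-* 2 (weight (half b)) ⟨
    ∑ᵛ (λ v → 2 * weight (half b) v)    ≡⟨ ∑ᵛ-cong pointwise ⟩
    ∑ᵛ (weight S ∘ (b ∷_))              ∎
    where
    swap₂ : ∀ x y → 2 * (x * y) ≡ x * (2 * y)
    swap₂ = solve-∀
    pointwise : ∀ v → 2 * weight (half b) v ≡ weight S (b ∷ v)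
    pointwise v rewrite empty v = swap₂ (𝟙 (S (b ∷ v))) _
  vanish : ∀ b → ¬ NonEmpty (half b) → ∀ v → S (b ∷ v) ≡ false
  vanish b ¬ne v = ¬-not λ p → ¬ne (v , p)
  go : Dec (NonEmpty (half false)) → Dec (NonEmpty (half true)) → 2 ^ suc n ≤ ∑ᵛ (weight S)
  go (yes f) (yes t) = begin
    2 ^ n + (2 ^ n + 0)  ≡⟨ cong (λ x → 2 ^ n + x) (+-identityʳ (2 ^ n)) ⟩
    2 ^ n + 2 ^ n        ≤⟨ +-mono-≤ (grow false (2^n≤∑weight (half false) f)) (grow true (2^n≤∑weight (half true) t)) ⟩
    ∑ᵛ (weight S)        ∎
  go (yes f) (no t) = ≤-trans (double false (vanish true t) (2^n≤∑weight (half false) f)) (m≤m+n _ _)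
  go (no f) (yes t) = ≤-trans (double true (vanish false f) (2^n≤∑weight (half true) t)) (m≤n+m _ _)
  go (no f) (no t) = ⊥-elim (absurd ne)
    where
    absurd : NonEmpty S → ⊥
    absurd (false ∷ v , p) = f (v , p)
    absurd (true ∷ v , p) = t (v , p)

SensBounded : ∀ {n} → ℕ → VertexSet n → Set
SensBounded k S = ∀ v → S v ≡ true → sens S v ≤ k

2^n≤size*2^k : ∀ {n} k (S : VertexSet n) → NonEmpty S → SensBounded k S → 2 ^ n ≤ size S * 2 ^ k
2^n≤size*2^k {n} k S ne bounded = begin
  2 ^ n                            ≤⟨ 2^n≤∑weight S ne ⟩
  ∑ᵛ (weight S)                    ≤⟨ ∑ᵛ-mono pointwise ⟩
  ∑ᵛ (λ v → 2 ^ k * 𝟙 (S v))       ≡⟨ ∑ᵛ-* (2 ^ k) (𝟙 ∘ S) ⟩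
  2 ^ k * size S                   ≡⟨ *-comm (2 ^ k) _ ⟩
  size S * 2 ^ k                   ∎
  where
  open ≤-Reasoning
  pointwise : ∀ v → weight S v ≤ 2 ^ k * 𝟙 (S v)
  pointwise v with S v in eq
  ... | true = ≤-trans (*-monoʳ-≤ 1 (^-monoʳ-≤ 2 (bounded v eq))) (≤-reflexive (*-comm 1 (2 ^ k)))
  ... | false = z≤n

-- The lower bound

-- With k = n - d this is |S| ≥ 2^(d+1) - 2^(2d-n), multiplied by 4^k so that no subtraction occurs.
SizeBound : ∀ {n} → ℕ → VertexSet n → Set
SizeBound {n} k S = 2 ^ n * 2 ^ suc k ≤ size S * 4 ^ k + 2 ^ n

LowerBound : ℕ → Set
LowerBound k = ∀ {n} (S : VertexSet n) → NonEmpty S → Irreducible S → SensBounded k S → SizeBound k S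

4^k≡2^k*2^k : ∀ k → 4 ^ k ≡ 2 ^ k * 2 ^ k
4^k≡2^k*2^k k = trans (cong (_^ k) {4} {2 * 2} refl) (^-distribʳ-* k 2 2)
  where
  ^-distribʳ-* : ∀ k a b → (a * b) ^ k ≡ a ^ k * b ^ k
  ^-distribʳ-* zero a b = refl
  ^-distribʳ-* (suc k) a b = trans (cong (a * b *_) (^-distribʳ-* k a b)) (interchange a b (a ^ k) (b ^ k))
    where
    interchange : ∀ a b c d → a * b * (c * d) ≡ a * c * (b * d)
    interchange = solve-∀

-- The three-quadrant inequality

module ThreeQuadrants {n} (k : ℕ) (A M B : VertexSet n)
  -- The summand 1 stands for the neighbour in the empty quadrant; the indicators stand for
  -- neighbours in the adjacent quadrants, of which `M` has two.
  (sens-A : ∀ v → A v ≡ true → sens A v + 1 + 𝟙 (not (M v)) ≤ k)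
  (sens-M : ∀ v → M v ≡ true → sens M v + 𝟙 (not (A v)) + 𝟙 (not (B v)) ≤ k)
  where

  A∪M : VertexSet n
  A∪M v = A v ∨ M v

  -- One outside neighbour is lost: for `v` in `A` the one in the empty quadrant, for `v` in `M` but
  -- not in `A` the one across to `A`, since the union identifies the two quadrants.
  A∪M-sens : ∀ {k'} → k ≡ suc k' → SensBounded k' A∪M
  A∪M-sens refl v p with A v in a
  ... | true = s≤s⁻¹ (begin
    suc (sens A∪M v)                   ≤⟨ s≤s (sens-anti {S = A} {A∪M} v λ i q → cong (_∨ M (flipAt v i)) q) ⟩
    suc (sens A v)                     ≡⟨ +-comm 1 (sens A v) ⟩
    sens A v + 1                       ≤⟨ m≤m+n _ _ ⟩
    sens A v + 1 + 𝟙 (not (M v))       ≤⟨ sens-A v a ⟩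
    k                                  ∎)
    where open ≤-Reasoning
  ... | false = s≤s⁻¹ (begin
    suc (sens A∪M v)                                  ≤⟨ s≤s (sens-anti {S = M} {A∪M} v λ i q → trans (cong (A (flipAt v i) ∨_) q) (∨-zeroʳ (A (flipAt v i)))) ⟩
    suc (sens M v)                                    ≡⟨ +-comm 1 (sens M v) ⟩
    sens M v + 1                                      ≡⟨ cong (λ b → sens M v + 𝟙 (not b)) a ⟨
    sens M v + 𝟙 (not (A v))                          ≤⟨ m≤m+n _ _ ⟩
    sens M v + 𝟙 (not (A v)) + 𝟙 (not (B v))          ≤⟨ sens-M v p ⟩
    k                                                 ∎)
    where open ≤-Reasoning

  -- Its sum is |A| + |A ∩ M|.
  A-weight : Vertex n → ℕ
  A-weight v = 𝟙 (A v) * (1 + 𝟙 (M v))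

  -- Simon's lemma for `A`. By `sens-A` the sensitivity is at most k - 1 on A ∩ M and at most k - 2
  -- on the rest of `A`; the weight 2 or 1 compensates for the difference.
  4*2^n≤∑A-weight*2^k : NonEmpty A → 4 * 2 ^ n ≤ ∑ᵛ A-weight * 2 ^ k
  4*2^n≤∑A-weight*2^k ne = begin
    4 * 2 ^ n                         ≤⟨ *-monoʳ-≤ 4 (2^n≤∑weight A ne) ⟩
    4 * ∑ᵛ (weight A)                 ≡⟨ ∑ᵛ-* 4 (weight A) ⟨
    ∑ᵛ (λ v → 4 * weight A v)         ≤⟨ ∑ᵛ-mono pointwise ⟩
    ∑ᵛ (λ v → 2 ^ k * A-weight v)     ≡⟨ ∑ᵛ-* (2 ^ k) A-weight ⟩
    2 ^ k * ∑ᵛ A-weight               ≡⟨ *-comm (2 ^ k) _ ⟩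
    ∑ᵛ A-weight * 2 ^ k               ∎
    where
    open ≤-Reasoning
    pointwise : ∀ v → 4 * weight A v ≤ 2 ^ k * A-weight v
    pointwise v with A v in a
    ... | false = z≤n
    ... | true with M v | sens-A v a
    ...   | true | h = begin
      4 * (1 * 2 ^ sens A v)        ≡⟨ regroup (2 ^ sens A v) ⟩
      2 ^ suc (sens A v) * 2        ≤⟨ *-monoˡ-≤ 2 (^-monoʳ-≤ 2 (subst (_≤ k) (reassoc (sens A v)) h)) ⟩
      2 ^ k * 2                     ∎
      where
      regroup : ∀ x → 4 * (1 * x) ≡ (2 * x) * 2
      regroup = solve-∀
      reassoc : ∀ x → x + 1 + 0 ≡ suc x
      reassoc = solve-∀
    ...   | false | h = begin
      4 * (1 * 2 ^ sens A v)        ≡⟨ regroup (2 ^ sens A v) ⟩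
      2 ^ (2 + sens A v) * 1        ≤⟨ *-monoˡ-≤ 1 (^-monoʳ-≤ 2 (subst (_≤ k) (reassoc (sens A v)) h)) ⟩
      2 ^ k * 1                     ∎
      where
      regroup : ∀ x → 4 * (1 * x) ≡ (2 * (2 * x)) * 1
      regroup = solve-∀
      reassoc : ∀ x → x + 1 + 1 ≡ 2 + x
      reassoc = solve-∀

  -- Adds 4 times the induction hypothesis for `A∪M` at k - 1 to 2^k times the Simon bound for `A`;
  -- both then carry the factor 4^k.
  one-side : NonEmpty A → Irreducible A∪M → (∀ {k'} → k ≡ suc k' → LowerBound k') →
    8 * (2 ^ n * 2 ^ k) ≤ (size A∪M + ∑ᵛ A-weight) * 4 ^ k + 4 * 2 ^ n
  one-side (a , p) irr IH = go k refl
    where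
    open ≤-Reasoning
    split : ∀ N K → 8 * (N * K) ≡ 4 * (N * K) + 4 * N * K
    split = solve-∀
    merge : ∀ x w N F K → 4 * (x * F + N) + w * (2 * K) * (2 * K) ≡ x * (4 * F) + w * (2 * K * (2 * K)) + 4 * N
    merge = solve-∀
    go : ∀ k₀ → k ≡ k₀ → 8 * (2 ^ n * 2 ^ k) ≤ (size A∪M + ∑ᵛ A-weight) * 4 ^ k + 4 * 2 ^ n
    -- For k = 0 there is no smaller case, but a vertex of `A` already has an outside neighbour, in
    -- the empty quadrant.
    go zero refl with () ← ≤-trans (subst (1 ≤_) (sym (+-assoc (sens A a) 1 _)) (m≤n⇒m≤o+n (sens A a) (s≤s z≤n))) (sens-A a p)
    go (suc k') refl = begin
      8 * (2 ^ n * 2 ^ k)                                                  ≡⟨ split (2 ^ n) (2 ^ k) ⟩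
      4 * (2 ^ n * 2 ^ k) + 4 * 2 ^ n * 2 ^ k
        ≤⟨ +-mono-≤ (*-monoʳ-≤ 4 (IH refl A∪M (a , cong (_∨ M a) p) irr (A∪M-sens refl)))
                    (*-monoˡ-≤ (2 ^ k) (4*2^n≤∑A-weight*2^k (a , p))) ⟩
      4 * (size A∪M * 4 ^ k' + 2 ^ n) + ∑ᵛ A-weight * 2 ^ k * 2 ^ k         ≡⟨ merge (size A∪M) (∑ᵛ A-weight) (2 ^ n) (4 ^ k') (2 ^ k') ⟩
      size A∪M * 4 ^ k + ∑ᵛ A-weight * (2 ^ k * 2 ^ k) + 4 * 2 ^ n         ≡⟨ cong (λ z → size A∪M * 4 ^ k + ∑ᵛ A-weight * z + 4 * 2 ^ n) (4^k≡2^k*2^k k) ⟨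
      size A∪M * 4 ^ k + ∑ᵛ A-weight * 4 ^ k + 4 * 2 ^ n                   ≡⟨ cong (_+ 4 * 2 ^ n) (*-distribʳ-+ (4 ^ k) (size A∪M) _) ⟨
      (size A∪M + ∑ᵛ A-weight) * 4 ^ k + 4 * 2 ^ n                         ∎

-- The sum of `one-side` for A, M and for B, M, halved. The factor 4 is there because quadrants will
-- be read on the whole n-cube, where each of their vertices is counted four times.
three-quadrants : ∀ {n} k (A M B : VertexSet n) →
  (∀ v → A v ≡ true → sens A v + 1 + 𝟙 (not (M v)) ≤ k) →
  (∀ v → M v ≡ true → sens M v + 𝟙 (not (A v)) + 𝟙 (not (B v)) ≤ k) →
  (∀ v → B v ≡ true → sens B v + 1 + 𝟙 (not (M v)) ≤ k) →
  NonEmpty A → NonEmpty B →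
  Irreducible (λ v → A v ∨ M v) → Irreducible (λ v → B v ∨ M v) →
  (∀ {k'} → k ≡ suc k' → LowerBound k') →
  4 * (2 ^ n * 2 ^ suc k) ≤ (size A + size M + size B) * 4 ^ k + 4 * 2 ^ n
three-quadrants {n} k A M B sens-A sens-M sens-B neA neB irrA irrB IH = *-cancelˡ-≤ 2 (begin
  2 * (4 * (2 ^ n * 2 ^ suc k))                       ≡⟨ split (2 ^ n) (2 ^ k) ⟩
  8 * (2 ^ n * 2 ^ k) + 8 * (2 ^ n * 2 ^ k)           ≤⟨ +-mono-≤ (Q.one-side neA irrA IH) (Q'.one-side neB irrB IH) ⟩
  (size Q.A∪M + ∑ᵛ Q.A-weight) * 4 ^ k + 4 * 2 ^ n
    + ((size Q'.A∪M + ∑ᵛ Q'.A-weight) * 4 ^ k + 4 * 2 ^ n)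
                                                      ≡⟨ merge (size Q.A∪M + ∑ᵛ Q.A-weight) (size Q'.A∪M + ∑ᵛ Q'.A-weight) (4 ^ k) (2 ^ n) ⟩
  ((size Q.A∪M + ∑ᵛ Q.A-weight) + (size Q'.A∪M + ∑ᵛ Q'.A-weight)) * 4 ^ k + 8 * 2 ^ n
                                                      ≤⟨ +-monoˡ-≤ (8 * 2 ^ n) (*-monoˡ-≤ (4 ^ k) total) ⟩
  2 * (size A + size M + size B) * 4 ^ k + 8 * 2 ^ n  ≡⟨ factor (size A + size M + size B) (4 ^ k) (2 ^ n) ⟩
  2 * ((size A + size M + size B) * 4 ^ k + 4 * 2 ^ n) ∎)
  where
  open ≤-Reasoning
  exchange : ∀ x y z → x + y + z ≡ x + z + y
  exchange = solve-∀
  module Q = ThreeQuadrants k A M B sens-A sens-M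
  module Q' = ThreeQuadrants k B M A sens-B (λ v m → subst (_≤ k) (exchange (sens M v) _ _) (sens-M v m))
  split : ∀ N K → 2 * (4 * (N * (2 * K))) ≡ 8 * (N * K) + 8 * (N * K)
  split = solve-∀
  merge : ∀ x y F N → x * F + 4 * N + (y * F + 4 * N) ≡ (x + y) * F + 8 * N
  merge = solve-∀
  factor : ∀ x F N → 2 * x * F + 8 * N ≡ 2 * (x * F + 4 * N)
  factor = solve-∀
  -- Each bracket equals 2a + m, since the overlap counted in the second term makes up for the union
  -- in the first; so equality holds in every case.
  pointwise : ∀ a m b → (𝟙 (a ∨ m) + 𝟙 a * (1 + 𝟙 m)) + (𝟙 (b ∨ m) + 𝟙 b * (1 + 𝟙 m)) ≤ 2 * (𝟙 a + 𝟙 m + 𝟙 b)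
  pointwise false false false = ≤-refl
  pointwise false false true = ≤-refl
  pointwise false true false = ≤-refl
  pointwise false true true = ≤-refl
  pointwise true false false = ≤-refl
  pointwise true false true = ≤-refl
  pointwise true true false = ≤-refl
  pointwise true true true = ≤-refl
  total : (size Q.A∪M + ∑ᵛ Q.A-weight) + (size Q'.A∪M + ∑ᵛ Q'.A-weight) ≤ 2 * (size A + size M + size B)
  total = begin
    (size Q.A∪M + ∑ᵛ Q.A-weight) + (size Q'.A∪M + ∑ᵛ Q'.A-weight)
      ≡⟨ cong₂ _+_ (∑ᵛ-+ (𝟙 ∘ Q.A∪M) Q.A-weight) (∑ᵛ-+ (𝟙 ∘ Q'.A∪M) Q'.A-weight) ⟨
    ∑ᵛ (λ v → 𝟙 (Q.A∪M v) + Q.A-weight v) + ∑ᵛ (λ v → 𝟙 (Q'.A∪M v) + Q'.A-weight v)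
      ≡⟨ ∑ᵛ-+ (λ v → 𝟙 (Q.A∪M v) + Q.A-weight v) _ ⟨
    ∑ᵛ (λ v → (𝟙 (Q.A∪M v) + Q.A-weight v) + (𝟙 (Q'.A∪M v) + Q'.A-weight v))
      ≤⟨ ∑ᵛ-mono (λ v → pointwise (A v) (M v) (B v)) ⟩
    ∑ᵛ (λ v → 2 * (𝟙 (A v) + 𝟙 (M v) + 𝟙 (B v)))
      ≡⟨ ∑ᵛ-* 2 (λ v → 𝟙 (A v) + 𝟙 (M v) + 𝟙 (B v)) ⟩
    2 * ∑ᵛ (λ v → 𝟙 (A v) + 𝟙 (M v) + 𝟙 (B v))
      ≡⟨ cong (2 *_) (trans (∑ᵛ-+ (λ v → 𝟙 (A v) + 𝟙 (M v)) (𝟙 ∘ B)) (cong (_+ size B) (∑ᵛ-+ (𝟙 ∘ A) (𝟙 ∘ M)))) ⟩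
    2 * (size A + size M + size B) ∎

-- Intersections of faces

Meets : ∀ {n} → VertexSet n → Fin n → Bool → Fin n → Bool → Set
Meets S i b j c = ∃ λ v → S v ≡ true × lookup v i ≡ b × lookup v j ≡ c

meets? : ∀ {n} (S : VertexSet n) i b j c → Dec (Meets S i b j c)
meets? S i b j c = ∃ᵛ? λ v → (S v ≟ true) ×-dec (lookup v i ≟ b) ×-dec (lookup v j ≟ c)

Meets-sym : ∀ {n} {S : VertexSet n} {i b j c} → Meets S i b j c → Meets S j c i b
Meets-sym (v , s , p , q) = v , s , q , p

-- Irreducibility of the face within the cube of the other coordinates, hence `l ≢ i`. For n = 1 it
-- is vacuous, so non-emptiness has to come from elsewhere.
FaceIrreducible : ∀ {n} → VertexSet n → Fin n → Bool → Set
FaceIrreducible S i b = ∀ l g → l ≢ i → Meets S i b l g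

faceIrreducible? : ∀ {n} (S : VertexSet n) i b →
  FaceIrreducible S i b ⊎ (∃₂ λ l g → l ≢ i × ¬ Meets S i b l g)
faceIrreducible? S i b with Fin.any? (λ l → ¬? (l Fin.≟ i) ×-dec (¬? (meets? S i b l false) ⊎-dec ¬? (meets? S i b l true)))
... | yes (l , l≢i , inj₁ d) = inj₂ (l , false , l≢i , d)
... | yes (l , l≢i , inj₂ d) = inj₂ (l , true , l≢i , d)
... | no none = inj₁ λ
  { l false l≢i → decidable-stable (meets? S i b l false) λ d → none (l , l≢i , inj₁ d)
  ; l true l≢i → decidable-stable (meets? S i b l true) λ d → none (l , l≢i , inj₂ d) }

-- Quadrants of two coordinates

module Overwrite {n} (i j : Fin n) (i≢j : i ≢ j) where

  ow : Vertex n → Bool → Bool → Vertex n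
  ow v β γ = (v [ i ]≔ β) [ j ]≔ γ

  flip-i : ∀ v β γ → flipAt (ow v β γ) i ≡ ow v (not β) γ
  flip-i v β γ = trans (updateAt-commutes i j i≢j (v [ i ]≔ β)) (cong (_[ j ]≔ γ) (updateAt-updateAt i v))

  flip-j : ∀ v β γ → flipAt (ow v β γ) j ≡ ow v β (not γ)
  flip-j v β γ = updateAt-updateAt j (v [ i ]≔ β)

  flip-other : ∀ l v β γ → l ≢ i → l ≢ j → flipAt (ow v β γ) l ≡ ow (flipAt v l) β γ
  flip-other l v β γ l≢i l≢j =
    trans (updateAt-commutes l j l≢j (v [ i ]≔ β)) (cong (_[ j ]≔ γ) (updateAt-commutes l i l≢i v))

  ignores-i : ∀ v (f : Bool → Bool) β γ → ow (updateAt v i f) β γ ≡ ow v β γ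
  ignores-i v f β γ = cong (_[ j ]≔ γ) (updateAt-updateAt i v)

  ignores-j : ∀ v (f : Bool → Bool) β γ → ow (updateAt v j f) β γ ≡ ow v β γ
  ignores-j v f β γ = trans (cong (_[ j ]≔ γ) (updateAt-commutes i j i≢j v)) (updateAt-updateAt j (v [ i ]≔ β))

  stable : ∀ v {β γ} → lookup v i ≡ β → lookup v j ≡ γ → ow v β γ ≡ v
  stable v refl refl = trans (cong (_[ j ]≔ lookup v j) ([]≔-lookup v i)) ([]≔-lookup v j)

  lookup-i : ∀ v β γ → lookup (ow v β γ) i ≡ β
  lookup-i v β γ = trans (lookup∘update′ i≢j (v [ i ]≔ β) γ) (lookup∘update i v β)

  lookup-j : ∀ v β γ → lookup (ow v β γ) j ≡ γ
  lookup-j v β γ = lookup∘update j (v [ i ]≔ β) γ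

  -- A quadrant stays a set on the n-cube, one that ignores `i` and `j`. The remaining n - 2
  -- coordinates need no renumbering and all quadrants live on the same cube.
  quadrant : VertexSet n → Bool → Bool → VertexSet n
  quadrant S β γ v = S (ow v β γ)

  -- Flipping `i` or `j` does not change membership in the quadrant, while in `S` it leads to the
  -- adjacent quadrants; in all other directions the two sensitivities agree.
  sens-quadrant : ∀ S v β γ → S (ow v β γ) ≡ true →
    sens (quadrant S β γ) v + 𝟙 (not (quadrant S (not β) γ v)) + 𝟙 (not (quadrant S β (not γ) v)) ≤ sens S (ow v β γ)
  sens-quadrant S v β γ p = ∑ᶜ-extract₂ i j i≢j
    (cong (𝟙 ∘ not) (trans (cong S (ignores-i v not β γ)) p))
    (cong (𝟙 ∘ not) (trans (cong S (ignores-j v not β γ)) p))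
    (≤-reflexive (cong (𝟙 ∘ not ∘ S) (sym (flip-i v β γ))))
    (≤-reflexive (cong (𝟙 ∘ not ∘ S) (sym (flip-j v β γ))))
    (λ l l≢i l≢j → ≤-reflexive (cong (𝟙 ∘ not ∘ S) (sym (flip-other l v β γ l≢i l≢j))))

  size-quadrants : ∀ S b c →
    (size (quadrant S b c) + size (quadrant S (not b) c)) + (size (quadrant S b (not c)) + size (quadrant S (not b) (not c))) ≡ 4 * size S
  size-quadrants S b c = begin
    (size (quadrant S b c) + size (quadrant S (not b) c)) + (size (quadrant S b (not c)) + size (quadrant S (not b) (not c)))
      ≡⟨ cong₂ _+_ (∑ᵛ-overwrite i b (λ v → 𝟙 (S (v [ j ]≔ c)))) (∑ᵛ-overwrite i b (λ v → 𝟙 (S (v [ j ]≔ not c)))) ⟩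
    2 * ∑ᵛ (λ v → 𝟙 (S (v [ j ]≔ c))) + 2 * ∑ᵛ (λ v → 𝟙 (S (v [ j ]≔ not c)))
      ≡⟨ *-distribˡ-+ 2 (∑ᵛ (λ v → 𝟙 (S (v [ j ]≔ c)))) _ ⟨
    2 * (∑ᵛ (λ v → 𝟙 (S (v [ j ]≔ c))) + ∑ᵛ (λ v → 𝟙 (S (v [ j ]≔ not c))))
      ≡⟨ cong (2 *_) (∑ᵛ-overwrite j c (𝟙 ∘ S)) ⟩
    2 * (2 * size S)
      ≡⟨ *-assoc 2 2 (size S) ⟨
    4 * size S ∎
    where open ≡-Reasoning

  -- Literals on i and j are attained for free, because quadrants ignore these coordinates.
  quadrant-irreducible : ∀ S b (T : VertexSet n) → (∀ v f → T (updateAt v i f) ≡ T v) → (∀ v f → T (updateAt v j f) ≡ T v) →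
    NonEmpty T → (∀ v → S v ≡ true → lookup v i ≡ b → T v ≡ true) → FaceIrreducible S i b → Irreducible T
  quadrant-irreducible S b T T-i T-j (t , p) S⇒T irr l g with l Fin.≟ i | l Fin.≟ j
  ... | yes refl | _ = t [ i ]≔ g , trans (T-i t _) p , lookup∘update i t g
  ... | no _ | yes refl = t [ j ]≔ g , trans (T-j t _) p , lookup∘update j t g
  ... | no l≢i | no _ with irr l g l≢i
  ...   | v , s , q , r = v , S⇒T v s q , r

-- The case in which no pair of smaller faces is available: the quadrant `E` is empty and the other
-- three satisfy the hypotheses of `three-quadrants`.
maximal-clause : ∀ {n} k (S : VertexSet n) → (∀ {k'} → k ≡ suc k' → LowerBound k') →
  Irreducible S → SensBounded k S → ∀ i b j c → i ≢ j → ¬ Meets S i b j c →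
  FaceIrreducible S i (not b) → FaceIrreducible S j (not c) → SizeBound k S
maximal-clause {n} k S IH irr bounded i b j c i≢j disjoint irr-i irr-j = *-cancelˡ-≤ 4 (begin
  4 * (2 ^ n * 2 ^ suc k)                              ≤⟨ three-quadrants k A M B sens-A sens-M sens-B neA neB irr-A irr-B IH ⟩
  (size A + size M + size B) * 4 ^ k + 4 * 2 ^ n       ≡⟨ cong (λ x → x * 4 ^ k + 4 * 2 ^ n) total ⟩
  4 * size S * 4 ^ k + 4 * 2 ^ n                       ≡⟨ factor (size S) (4 ^ k) (2 ^ n) ⟩
  4 * (size S * 4 ^ k + 2 ^ n)                         ∎)
  where
  open ≤-Reasoning
  open Overwrite i j i≢j
  factor : ∀ x F N → 4 * x * F + 4 * N ≡ 4 * (x * F + N)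
  factor = solve-∀
  A M B E : VertexSet n
  A = quadrant S (not b) c
  M = quadrant S (not b) (not c)
  B = quadrant S b (not c)
  E = quadrant S b c
  E-empty : ∀ v → E v ≡ false
  E-empty v = ¬-not λ p → disjoint (ow v b c , p , lookup-i v b c , lookup-j v b c)
  total : size A + size M + size B ≡ 4 * size S
  total = trans (shuffle (size A) (size M) (size B))
    (trans (cong (λ e → (e + size A) + (size B + size M)) (sym (trans (∑ᵛ-cong (cong 𝟙 ∘ E-empty)) (∑ᵛ-zero {n})))) (size-quadrants S b c))
    where
    shuffle : ∀ a m b → a + m + b ≡ (0 + a) + (b + m)
    shuffle = solve-∀
  -- The quadrant across direction `i` is that of `not (not b)` and `c`, which is the empty `E`;
  -- this supplies the summand 1.
  sens-A : ∀ v → A v ≡ true → sens A v + 1 + 𝟙 (not (M v)) ≤ k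
  sens-A v p = ≤-trans (subst (λ e → sens A v + 𝟙 (not e) + 𝟙 (not (M v)) ≤ sens S (ow v (not b) c))
    (trans (cong (λ β → S (ow v β c)) (not-involutive b)) (E-empty v)) (sens-quadrant S v (not b) c p)) (bounded _ p)
  sens-B : ∀ v → B v ≡ true → sens B v + 1 + 𝟙 (not (M v)) ≤ k
  sens-B v p = ≤-trans (subst (_≤ sens S (ow v b (not c))) (exchange (sens B v) (𝟙 (not (M v))))
    (subst (λ e → sens B v + 𝟙 (not (M v)) + 𝟙 (not e) ≤ sens S (ow v b (not c)))
    (trans (cong (λ γ → S (ow v b γ)) (not-involutive c)) (E-empty v)) (sens-quadrant S v b (not c) p))) (bounded _ p)
    where
    exchange : ∀ x y → x + y + 1 ≡ x + 1 + y
    exchange = solve-∀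
  sens-M : ∀ v → M v ≡ true → sens M v + 𝟙 (not (A v)) + 𝟙 (not (B v)) ≤ k
  sens-M v p = ≤-trans (subst₂ (λ β γ → sens M v + 𝟙 (not (S (ow v (not b) γ))) + 𝟙 (not (S (ow v β (not c)))) ≤ sens S (ow v (not b) (not c)))
    (not-involutive b) (not-involutive c)
    (subst (_≤ sens S (ow v (not b) (not c))) (exchange (sens M v) _ _) (sens-quadrant S v (not b) (not c) p))) (bounded _ p)
    where
    exchange : ∀ x y z → x + y + z ≡ x + z + y
    exchange = solve-∀
  -- Some vertex of `S` has x_j = c, and disjointness forces x_i = not b there.
  neA : NonEmpty A
  neA with irr j c
  ... | v , s , q = v , trans (cong S (stable v (¬-not λ p → disjoint (v , s , p , q)) q)) s
  neB : NonEmpty B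
  neB with irr i b
  ... | v , s , p = v , trans (cong S (stable v p (¬-not λ q → disjoint (v , s , p , q)))) s
  -- `A` and `M` together make up the face x_i = not b of `S`, so the union inherits its
  -- irreducibility.
  in-A∪M : ∀ v → S v ≡ true → lookup v i ≡ not b → A v ∨ M v ≡ true
  in-A∪M v s p with lookup v j ≟ c
  ... | yes q = cong (_∨ M v) (trans (cong S (stable v p q)) s)
  ... | no q = trans (cong (A v ∨_) (trans (cong S (stable v p (¬-not q))) s)) (∨-zeroʳ (A v))
  in-B∪M : ∀ v → S v ≡ true → lookup v j ≡ not c → B v ∨ M v ≡ true
  in-B∪M v s q with lookup v i ≟ b
  ... | yes p = cong (_∨ M v) (trans (cong S (stable v p q)) s)
  ... | no p = trans (cong (B v ∨_) (trans (cong S (stable v (¬-not p) q)) s)) (∨-zeroʳ (B v))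
  irr-A : Irreducible (λ v → A v ∨ M v)
  irr-A = quadrant-irreducible S (not b) _
    (λ v f → cong₂ _∨_ (cong S (ignores-i v f _ _)) (cong S (ignores-i v f _ _)))
    (λ v f → cong₂ _∨_ (cong S (ignores-j v f _ _)) (cong S (ignores-j v f _ _)))
    (proj₁ neA , cong (_∨ M (proj₁ neA)) (proj₂ neA)) in-A∪M irr-i
  irr-B : Irreducible (λ v → B v ∨ M v)
  irr-B = Overwrite.quadrant-irreducible j i (i≢j ∘ sym) S (not c) _
    (λ v f → cong₂ _∨_ (cong S (ignores-j v f _ _)) (cong S (ignores-j v f _ _)))
    (λ v f → cong₂ _∨_ (cong S (ignores-i v f _ _)) (cong S (ignores-i v f _ _)))
    (proj₁ neB , cong (_∨ M (proj₁ neB)) (proj₂ neB)) in-B∪M irr-j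

-- Descent to a smallest pair of disjoint faces

face : ∀ {n} → VertexSet n → Fin n → Bool → VertexSet n
face S i b v = S v ∧ does (lookup v i ≟ b)

face⁺ : ∀ {n} (S : VertexSet n) i b v → S v ≡ true → lookup v i ≡ b → face S i b v ≡ true
face⁺ S i b v s p = cong₂ _∧_ s (dec-true (lookup v i ≟ b) p)

face⁻ : ∀ {n} (S : VertexSet n) i b v → face S i b v ≡ true → S v ≡ true × lookup v i ≡ b
face⁻ S i b v f with S v | lookup v i ≟ b
face⁻ S i b v f | true | yes p = refl , p
face⁻ S i b v () | true | no _
face⁻ S i b v () | false | _

-- If x_i = b and x_j = not c are equivalent on S then no edge of S has direction i,
-- so the two faces keep the degrees of S.
equivalent-literals : ∀ {n} k (S : VertexSet n) → Irreducible S → SensBounded k S →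
  ∀ i b j c → i ≢ j → ¬ Meets S i b j c → ¬ Meets S i (not b) j (not c) → SizeBound k S
equivalent-literals {n} k S irr bounded i b j c i≢j d₁ d₂ = ≤-trans (begin
  2 ^ n * 2 ^ suc k                           ≡⟨ split (2 ^ n) (2 ^ k) ⟩
  (2 ^ n + 2 ^ n) * 2 ^ k
    ≤⟨ *-monoˡ-≤ (2 ^ k) (+-mono-≤ (face-large b c d₁ d₂) (face-large (not b) (not c) d₂ (subst₂ (λ β γ → ¬ Meets S i β j γ) (sym (not-involutive b)) (sym (not-involutive c)) d₁))) ⟩
  (size (face S i b) * 2 ^ k + size (face S i (not b)) * 2 ^ k) * 2 ^ k
    ≡⟨ cong (_* 2 ^ k) (*-distribʳ-+ (2 ^ k) (size (face S i b)) _) ⟨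
  (size (face S i b) + size (face S i (not b))) * 2 ^ k * 2 ^ k
    ≡⟨ cong (λ x → x * 2 ^ k * 2 ^ k) (trans (sym (∑ᵛ-+ (𝟙 ∘ face S i b) _)) (∑ᵛ-cong λ v → partition (S v) (lookup v i) b)) ⟩
  size S * 2 ^ k * 2 ^ k                      ≡⟨ *-assoc (size S) (2 ^ k) (2 ^ k) ⟩
  size S * (2 ^ k * 2 ^ k)                    ≡⟨ cong (size S *_) (4^k≡2^k*2^k k) ⟨
  size S * 4 ^ k                              ∎) (m≤m+n _ _)
  where
  open ≤-Reasoning
  split : ∀ N K → N * (2 * K) ≡ (N + N) * K
  split = solve-∀
  partition : ∀ s a b → 𝟙 (s ∧ does (a ≟ b)) + 𝟙 (s ∧ does (a ≟ not b)) ≡ 𝟙 s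
  partition false a b = refl
  partition true false false = refl
  partition true false true = refl
  partition true true false = refl
  partition true true true = refl
  face-large : ∀ b c → ¬ Meets S i b j c → ¬ Meets S i (not b) j (not c) → 2 ^ n ≤ size (face S i b) * 2 ^ k
  face-large b c d₁ d₂ = 2^n≤size*2^k k (face S i b) nonempty λ v f →
    ≤-trans (sens-anti {S = S} {face S i b} v (stays v f)) (bounded v (proj₁ (face⁻ S i b v f)))
    where
    nonempty : NonEmpty (face S i b)
    nonempty with irr i b
    ... | v , s , p = v , face⁺ S i b v s p
    stays : ∀ v → face S i b v ≡ true → ∀ l → S (flipAt v l) ≡ true → face S i b (flipAt v l) ≡ true
    stays v f l s' with face⁻ S i b v f | l Fin.≟ i
    ... | s , p | no l≢i = face⁺ S i b (flipAt v l) s' (trans (lookup∘updateAt′ i l (l≢i ∘ sym) v) p)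
    -- By `d₁` the vertex has x_j = not c, so flipping x_i would lead into the second missed
    -- intersection.
    ... | s , p | yes refl = ⊥-elim (d₂ (flipAt v i , s' ,
            trans (lookup∘updateAt i v) (cong not p) ,
            trans (lookup∘updateAt′ j i (i≢j ∘ sym) v) (¬-not λ q → d₁ (v , s , p , q))))

-- If the face x_i = not b of S misses x_l = g, then x_l = g implies x_i = b on S,
-- so the pair (l, g) can replace (i, b).
strengthen : ∀ {n} k (S : VertexSet n) → Irreducible S → SensBounded k S →
  ∀ i b j c → i ≢ j → ¬ Meets S i b j c →
  FaceIrreducible S i (not b) ⊎ SizeBound k S ⊎
  (∃₂ λ l g → l ≢ j × ¬ Meets S l g j c × size (face S l g) < size (face S i b))
strengthen k S irr bounded i b j c i≢j disjoint with faceIrreducible? S i (not b)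
... | inj₁ irr-i = inj₁ irr-i
... | inj₂ (l , g , l≢i , d) with meets? S i b l (not g)
-- Both mixed intersections are missed: x_i = b and x_l = g are equivalent on `S`.
...   | no d' = inj₂ (inj₁ (equivalent-literals k S irr bounded i b l (not g) (l≢i ∘ sym) d'
          (subst (λ g → ¬ Meets S i (not b) l g) (sym (not-involutive g)) d)))
-- The vertex `w` lies in the face x_i = b but not in the face x_l = g, which makes the inclusion of
-- these faces strict.
...   | yes (w , w∈S , wi , wl) with l Fin.≟ j | g ≟ c
-- Here x_j = c is excluded both with x_i = b and with x_i = not b, against irreducibility.
...     | yes refl | yes refl = ⊥-elim (unattained (irr l g))
  where
  unattained : ¬ (∃ λ v → S v ≡ true × lookup v l ≡ g)
  unattained (v , s , q) with lookup v i ≟ b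
  ... | yes p = disjoint (v , s , p , q)
  ... | no p = d (v , s , ¬-not p , q)
-- Now not g = c, so `w` itself lies in the intersection assumed to be missed.
...     | yes refl | no g≢c = ⊥-elim (disjoint (w , w∈S , wi , trans wl (sym (¬-not (g≢c ∘ sym)))))
...     | no l≢j | _ = inj₂ (inj₂ (l , g , l≢j , disjoint' , ∑ᵛ-mono-< w shrink strict))
  where
  g⇒b : ∀ v → S v ≡ true → lookup v l ≡ g → lookup v i ≡ b
  g⇒b v s q = decidable-stable (lookup v i ≟ b) λ p → d (v , s , ¬-not p , q)
  disjoint' : ¬ Meets S l g j c
  disjoint' (v , s , p , q) = disjoint (v , s , g⇒b v s p , q)
  shrink : ∀ v → 𝟙 (face S l g v) ≤ 𝟙 (face S i b v)
  shrink v with face S l g v in f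
  ... | false = z≤n
  ... | true with s , q ← face⁻ S l g v f = ≤-reflexive (cong 𝟙 (sym (face⁺ S i b v s (g⇒b v s q))))
  strict : 𝟙 (face S l g w) < 𝟙 (face S i b w)
  strict rewrite face⁺ S i b w w∈S wi | ¬-not (λ f → not-¬ (proj₂ (face⁻ S l g w f)) wl) = s≤s z≤n

-- Each strengthening shrinks one face and keeps the other, so the sum of the two sizes decreases.
-- When neither literal can be strengthened, both opposite faces are irreducible.
from-clause : ∀ {n} k (S : VertexSet n) → (∀ {k'} → k ≡ suc k' → LowerBound k') →
  Irreducible S → SensBounded k S → ∀ i b j c → i ≢ j → ¬ Meets S i b j c → SizeBound k S
from-clause k S IH irr bounded i b j c i≢j disjoint = go _ i b j c i≢j disjoint ≤-refl
  where
  -- `fuel` strictly exceeds the sum of the face sizes; `≤-refl` fixes its initial value at one more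
  -- than that sum.
  go : ∀ fuel i b j c → i ≢ j → ¬ Meets S i b j c → size (face S i b) + size (face S j c) < fuel → SizeBound k S
  go (suc fuel) i b j c i≢j disjoint (s≤s enough)
    with strengthen k S irr bounded i b j c i≢j disjoint
       | strengthen k S irr bounded j c i b (i≢j ∘ sym) (disjoint ∘ Meets-sym)
  ... | inj₂ (inj₁ goal) | _ = goal
  ... | inj₂ (inj₂ (l , g , l≢j , d , smaller)) | _ =
    go fuel l g j c l≢j d (<-≤-trans (+-monoˡ-< (size (face S j c)) smaller) enough)
  ... | inj₁ _ | inj₂ (inj₁ goal) = goal
  ... | inj₁ _ | inj₂ (inj₂ (l , g , l≢i , d , smaller)) =
    go fuel i b l g (l≢i ∘ sym) (d ∘ Meets-sym) (<-≤-trans (+-monoʳ-< (size (face S i b)) smaller) enough)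
  ... | inj₁ irr-i | inj₁ irr-j = maximal-clause k S IH irr bounded i b j c i≢j disjoint irr-i irr-j

-- The recursion is lexicographic: a missed intersection leads to a smaller `k` in the same
-- dimension, splitting along the first coordinate keeps `k` and lowers the dimension.
lowerBound : ∀ k → LowerBound k
lowerBound k {zero} S ([] , p) irr bounded rewrite p = begin
  2 ^ 0 * 2 ^ suc k        ≡⟨ *-identityˡ (2 ^ suc k) ⟩
  2 ^ suc k                ≤⟨ 2^[1+k]≤4^k+1 k ⟩
  4 ^ k + 1                ≡⟨ cong (_+ 1) (*-identityˡ (4 ^ k)) ⟨
  1 * 4 ^ k + 1            ∎
  where
  open ≤-Reasoning
  -- In dimension 0 the claim amounts to (2^k - 1)^2 ≥ 0.
  2^[1+k]≤4^k+1 : ∀ k → 2 ^ suc k ≤ 4 ^ k + 1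
  2^[1+k]≤4^k+1 zero = ≤-refl
  2^[1+k]≤4^k+1 (suc k) = begin
    2 ^ suc (suc k)     ≤⟨ ^-monoʳ-≤ 2 (+-monoʳ-≤ 2 (m≤m+n k k)) ⟩
    2 ^ (2 + (k + k))   ≡⟨ trans (cong (λ x → 2 * (2 * x)) (^-distribˡ-+-* 2 k k)) (regroup (2 ^ k)) ⟩
    4 * (2 ^ k * 2 ^ k) ≡⟨ cong (4 *_) (4^k≡2^k*2^k k) ⟨
    4 ^ suc k           ≤⟨ m≤m+n _ 1 ⟩
    4 ^ suc k + 1       ∎
    where
    regroup : ∀ x → 2 * (2 * (x * x)) ≡ 4 * (x * x)
    regroup = solve-∀
lowerBound k {suc n} S ne irr bounded with faceIrreducible? S zero false | faceIrreducible? S zero true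
... | inj₂ (l , g , l≢0 , d) | _ = from-clause k S (λ { {k'} refl → lowerBound k' }) irr bounded zero false l g (l≢0 ∘ sym) d
... | inj₁ _ | inj₂ (l , g , l≢0 , d) = from-clause k S (λ { {k'} refl → lowerBound k' }) irr bounded zero true l g (l≢0 ∘ sym) d
... | inj₁ irr₀ | inj₁ irr₁ = begin
  2 ^ suc n * 2 ^ suc k                              ≡⟨ split (2 ^ n) (2 ^ suc k) ⟩
  2 ^ n * 2 ^ suc k + 2 ^ n * 2 ^ suc k              ≤⟨ +-mono-≤ (half false irr₀) (half true irr₁) ⟩
  (size (S ∘ (false ∷_)) * 4 ^ k + 2 ^ n) + (size (S ∘ (true ∷_)) * 4 ^ k + 2 ^ n)
                                                     ≡⟨ merge (size (S ∘ (false ∷_))) (size (S ∘ (true ∷_))) (4 ^ k) (2 ^ n) ⟩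
  size S * 4 ^ k + 2 ^ suc n                         ∎
  where
  open ≤-Reasoning
  split : ∀ N K → 2 * N * K ≡ N * K + N * K
  split = solve-∀
  merge : ∀ x y F N → x * F + N + (y * F + N) ≡ (x + y) * F + 2 * N
  merge = solve-∀
  nonempty : ∀ b → NonEmpty (S ∘ (b ∷_))
  nonempty b with irr zero b
  ... | (.b ∷ v) , s , refl = v , s
  half : ∀ b → FaceIrreducible S zero b → SizeBound k (S ∘ (b ∷_))
  half b irr-b = lowerBound k (S ∘ (b ∷_)) (nonempty b) face-irr
    λ v s → ≤-trans (m≤n+m _ (𝟙 (not (S (not b ∷ v))))) (bounded (b ∷ v) s)
    where
    face-irr : Irreducible (S ∘ (b ∷_))
    face-irr l g with irr-b (suc l) g (λ ())
    ... | (.b ∷ v) , s , refl , q = v , s , q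

-- The ceiling

-- Negation on ℚ is defined by cases on the numerator, so the split lets it compute; what remains is
-- the floor of -p.
ceiling-def : ∀ p → ceiling p ≡ ℤ.- ((ℤ.- ↥ p) /ℕ ↧ₙ p)
ceiling-def (mkℚ -[1+ n ] d-1 c) = cong ℤ.-_ (div-pos-is-/ℕ +[1+ n ] (suc d-1))
ceiling-def (mkℚ (+ 0) d-1 c) = cong ℤ.-_ (div-pos-is-/ℕ (+ 0) (suc d-1))
ceiling-def (mkℚ +[1+ n ] d-1 c) = cong ℤ.-_ (div-pos-is-/ℕ -[1+ n ] (suc d-1))

-- The fraction x / m need not be in lowest terms, so equality with `p` is given by
-- cross-multiplication. The division inequalities for the floor `f` of -p are carried over from the
-- reduced denominator to `m`.
module Ceiling (p : ℚ) (x : ℤ) (m : ℕ) .{{_ : NonZero m}} (p≡x/m : ↥ p ℤ.* + m ≡ x ℤ.* ↧ p) (c : ℤ) where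

  private
    f : ℤ
    f = (ℤ.- ↥ p) /ℕ ↧ₙ p

    instance
      m>0 : ℤ.Positive (+ m)
      m>0 = ℤ.positive (ℤ.+<+ (>-nonZero⁻¹ m))

    exchange : ∀ a b c → a ℤ.* b ℤ.* c ≡ a ℤ.* c ℤ.* b
    exchange = ℤ-Solver.solve-∀

    rescale : ℤ.- ↥ p ℤ.* + m ≡ ℤ.- x ℤ.* ↧ p
    rescale = trans (sym (ℤ.neg-distribˡ-* (↥ p) (+ m))) (trans (cong ℤ.-_ p≡x/m) (ℤ.neg-distribˡ-* x (↧ p)))

    fm≤-x : f ℤ.* + m ℤ.≤ ℤ.- x
    fm≤-x = ℤ.*-cancelʳ-≤-pos _ _ (↧ p) (begin
      f ℤ.* + m ℤ.* ↧ p      ≡⟨ exchange f (+ m) (↧ p) ⟩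
      f ℤ.* ↧ p ℤ.* + m      ≤⟨ ℤ.*-monoʳ-≤-nonNeg (+ m) ([n/ℕd]*d≤n (ℤ.- ↥ p) (↧ₙ p)) ⟩
      ℤ.- ↥ p ℤ.* + m        ≡⟨ rescale ⟩
      ℤ.- x ℤ.* ↧ p          ∎)
      where open ℤ.≤-Reasoning

    -x<[1+f]m : ℤ.- x ℤ.< ℤ.suc f ℤ.* + m
    -x<[1+f]m = ℤ.*-cancelʳ-<-nonNeg (↧ p) (begin-strict
      ℤ.- x ℤ.* ↧ p                ≡⟨ rescale ⟨
      ℤ.- ↥ p ℤ.* + m              <⟨ ℤ.*-monoʳ-<-pos (+ m) (n<s[n/ℕd]*d (ℤ.- ↥ p) (↧ₙ p)) ⟩
      ℤ.suc f ℤ.* ↧ p ℤ.* + m      ≡⟨ exchange (ℤ.suc f) (↧ p) (+ m) ⟩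
      ℤ.suc f ℤ.* + m ℤ.* ↧ p      ∎)
      where open ℤ.≤-Reasoning

    <suc⇒≤ : ∀ {i j} → i ℤ.< ℤ.suc j → i ℤ.≤ j
    <suc⇒≤ {i} {j} i<1+j = subst (i ℤ.≤_) (ℤ.pred-suc j) (ℤ.i<j⇒i≤pred[j] i<1+j)

  ceiling-≤ : x ℤ.≤ c ℤ.* + m → ceiling p ℤ.≤ c
  ceiling-≤ x≤cm = begin
    ceiling p        ≡⟨ ceiling-def p ⟩
    ℤ.- f            ≤⟨ ℤ.neg-mono-≤ (<suc⇒≤ (ℤ.*-cancelʳ-<-nonNeg (+ m) -cm<[1+f]m)) ⟩
    ℤ.- (ℤ.- c)      ≡⟨ ℤ.neg-involutive c ⟩
    c                ∎
    where
    open ℤ.≤-Reasoning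
    -cm<[1+f]m : ℤ.- c ℤ.* + m ℤ.< ℤ.suc f ℤ.* + m
    -cm<[1+f]m = begin-strict
      ℤ.- c ℤ.* + m      ≡⟨ ℤ.neg-distribˡ-* c (+ m) ⟨
      ℤ.- (c ℤ.* + m)    ≤⟨ ℤ.neg-mono-≤ x≤cm ⟩
      ℤ.- x              <⟨ -x<[1+f]m ⟩
      ℤ.suc f ℤ.* + m    ∎

  -- The hypothesis is x / m > c - 1, negated to fit the floor of -p.
  ≤-ceiling : ℤ.- x ℤ.< ℤ.suc (ℤ.- c) ℤ.* + m → c ℤ.≤ ceiling p
  ≤-ceiling -x<m-cm = begin
    c                ≡⟨ ℤ.neg-involutive c ⟨
    ℤ.- (ℤ.- c)      ≤⟨ ℤ.neg-mono-≤ (<suc⇒≤ (ℤ.*-cancelʳ-<-nonNeg (+ m) (ℤ.≤-<-trans fm≤-x -x<m-cm))) ⟩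
    ℤ.- f            ≡⟨ ceiling-def p ⟨
    ceiling p        ∎
    where open ℤ.≤-Reasoning

-- Passing to unnormalised rationals turns the difference into an explicit fraction with denominator
-- 1 * m, free of gcds.
difference-fraction : ∀ (a b : ℤ) (m : ℕ) .{{_ : NonZero m}} →
  let p = a ℚ./ 1 ℚ.- b ℚ./ m in ↥ p ℤ.* + m ≡ (a ℤ.* + m ℤ.- b) ℤ.* ↧ p
difference-fraction a b (suc m-1) = begin
  ↥ p ℤ.* + m                         ≡⟨ cong₂ ℤ._*_ (sym (ℚ.↥ᵘ-toℚᵘ p)) (sym (ℤ.*-identityˡ (+ m))) ⟩
  ℚᵘ.↥ ℚ.toℚᵘ p ℤ.* (+ 1 ℤ.* + m)     ≡⟨ ℚᵘ.drop-*≡* p≃ ⟩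
  (a ℤ.* + m ℤ.+ ℤ.- b ℤ.* + 1) ℤ.* ℚᵘ.↧ ℚ.toℚᵘ p  ≡⟨ cong₂ (λ y z → (a ℤ.* + m ℤ.+ y) ℤ.* z) (ℤ.*-identityʳ (ℤ.- b)) (ℚ.↧ᵘ-toℚᵘ p) ⟩
  (a ℤ.* + m ℤ.- b) ℤ.* ↧ p           ∎
  where
  open ≡-Reasoning
  m = suc m-1
  p = a ℚ./ 1 ℚ.- b ℚ./ m
  p≃ : ℚ.toℚᵘ p ≃ mkℚᵘ a 0 ℚᵘ.- mkℚᵘ b m-1
  p≃ = ℚᵘ.≃-trans (ℚ.toℚᵘ-homo-+ (a ℚ./ 1) (ℚ.- (b ℚ./ m)))
    (ℚᵘ.+-cong (ℚ.toℚᵘ-fromℚᵘ (mkℚᵘ a 0))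
      (ℚᵘ.≃-trans (ℚ.toℚᵘ-homo‿- (b ℚ./ m)) (ℚᵘ.-‿cong (ℚ.toℚᵘ-fromℚᵘ (mkℚᵘ b m-1)))))

module Bound (n d N : ℕ) where
  private
    a b m : ℕ
    a = 2 ^ suc d
    b = 2 ^ (2 * d)
    m = 2 ^ n

    instance
      m≢0 : NonZero m
      m≢0 = m^n≢0 2 n

    x : ℤ
    x = + a ℤ.* + m ℤ.- + b

    open Ceiling (+ a ℚ./ 1 ℚ.- + b ℚ./ m) x m (difference-fraction (+ a) (+ b) m) (+ N)

    homo : ∀ s t u → + (s * t + u) ≡ + s ℤ.* + t ℤ.+ + u
    homo s t u = cong (ℤ._+ + u) (ℤ.pos-* s t)

  bound-≤ : a * m ≤ N * m + b → bound n d ℤ.≤ + N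
  bound-≤ h = ceiling-≤ (begin
    + a ℤ.* + m ℤ.- + b                      ≡⟨ cong (ℤ._- + b) (ℤ.pos-* a m) ⟨
    + (a * m) ℤ.- + b                        ≤⟨ ℤ.+-monoˡ-≤ (ℤ.- + b) (ℤ.+≤+ h) ⟩
    + (N * m + b) ℤ.- + b                    ≡⟨ cong (ℤ._- + b) (homo N m b) ⟩
    (+ N ℤ.* + m ℤ.+ + b) ℤ.- + b            ≡⟨ cancel (+ N ℤ.* + m) (+ b) ⟩
    + N ℤ.* + m                              ∎)
    where
    open ℤ.≤-Reasoning
    cancel : ∀ y z → (y ℤ.+ z) ℤ.- z ≡ y
    cancel = ℤ-Solver.solve-∀

  -- The hypothesis is N - 1 < a - b / m with denominators cleared; adding `shift` to both sides
  -- brings it to the form of `≤-ceiling`.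
  ≤-bound : N * m + b < a * m + m → + N ℤ.≤ bound n d
  ≤-bound h = ≤-ceiling (begin-strict
    ℤ.- (+ a ℤ.* + m ℤ.- + b)                                            ≡⟨ expand (+ a ℤ.* + m) (+ b) (+ N ℤ.* + m) ⟩
    (+ N ℤ.* + m ℤ.+ + b) ℤ.+ shift          ≡⟨ cong (ℤ._+ shift) (homo N m b) ⟨
    + (N * m + b) ℤ.+ shift                  <⟨ ℤ.+-monoˡ-< (shift) (ℤ.+<+ h) ⟩
    + (a * m + m) ℤ.+ shift                  ≡⟨ cong (ℤ._+ shift) (homo a m m) ⟩
    (+ a ℤ.* + m ℤ.+ + m) ℤ.+ shift          ≡⟨ collect (+ a ℤ.* + m) (+ m) (+ N) ⟩
    ℤ.suc (ℤ.- + N) ℤ.* + m                                              ∎)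
    where
    open ℤ.≤-Reasoning
    shift : ℤ
    shift = ℤ.- (+ a ℤ.* + m ℤ.+ + N ℤ.* + m)
    expand : ∀ y z w → ℤ.- (y ℤ.- z) ≡ (w ℤ.+ z) ℤ.+ ℤ.- (y ℤ.+ w)
    expand = ℤ-Solver.solve-∀
    collect : ∀ y m c → (y ℤ.+ m) ℤ.+ ℤ.- (y ℤ.+ c ℤ.* m) ≡ (+ 1 ℤ.+ ℤ.- c) ℤ.* m
    collect = ℤ-Solver.solve-∀

-- Unions of two subcubes

wt : ∀ {n} → Vec Bool n → ℕ
wt [] = 0
wt (b ∷ m) = 𝟙 b + wt m

-- The subcube is given by a mask of its prescribed coordinates, all set to the same bit; `wt` of
-- the mask is its codimension.
cube : ∀ {n} → Bool → Vec Bool n → VertexSet n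
cube b [] [] = true
cube b (false ∷ m) (x ∷ v) = cube b m v
cube b (true ∷ m) (x ∷ v) = does (x ≟ b) ∧ cube b m v

private
  double-left : ∀ s F N → s * F ≡ N → (s + s) * F ≡ 2 * N
  double-left s F N h = trans (distrib s F) (cong (2 *_) h)
    where
    distrib : ∀ s F → (s + s) * F ≡ 2 * (s * F)
    distrib = solve-∀

  double-right : ∀ s F N → s * F ≡ N → s * (2 * F) ≡ 2 * N
  double-right s F N h = trans (commute s F) (cong (2 *_) h)
    where
    commute : ∀ s F → s * (2 * F) ≡ 2 * (s * F)
    commute = solve-∀

size-cube : ∀ {n} b (m : Vec Bool n) → size (cube b m) * 2 ^ wt m ≡ 2 ^ n
size-cube b [] = refl
size-cube b (false ∷ m) = double-left (size (cube b m)) (2 ^ wt m) _ (size-cube b m)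
size-cube {suc n} false (true ∷ m) rewrite ∑ᵛ-zero {n} | +-identityʳ (size (cube false m)) =
  double-right (size (cube false m)) (2 ^ wt m) _ (size-cube false m)
size-cube {suc n} true (true ∷ m) rewrite ∑ᵛ-zero {n} =
  double-right (size (cube true m)) (2 ^ wt m) _ (size-cube true m)

Disjoint : ∀ {n} → Vec Bool n → Vec Bool n → Set
Disjoint m m' = ∀ i → lookup m i ∧ lookup m' i ≡ false

-- For disjoint masks the prescriptions never conflict, so the intersection is again a subcube and
-- the codimensions add.
size-cube-∩ : ∀ {n} (m m' : Vec Bool n) → Disjoint m m' →
  size (λ v → cube false m v ∧ cube true m' v) * 2 ^ (wt m + wt m') ≡ 2 ^ n
size-cube-∩ [] [] dis = refl
size-cube-∩ (false ∷ m) (false ∷ m') dis =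
  double-left (size (λ v → cube false m v ∧ cube true m' v)) (2 ^ (wt m + wt m')) _ (size-cube-∩ m m' (dis ∘ suc))
size-cube-∩ {suc n} (true ∷ m) (false ∷ m') dis
  rewrite ∑ᵛ-zero {n} | +-identityʳ (size (λ v → cube false m v ∧ cube true m' v)) =
  double-right (size (λ v → cube false m v ∧ cube true m' v)) (2 ^ (wt m + wt m')) _ (size-cube-∩ m m' (dis ∘ suc))
size-cube-∩ {suc n} (false ∷ m) (true ∷ m') dis
  rewrite trans (∑ᵛ-cong (λ v → cong 𝟙 (∧-zeroʳ (cube false m v)))) (∑ᵛ-zero {n}) | +-suc (wt m) (wt m') =
  double-right (size (λ v → cube false m v ∧ cube true m' v)) (2 ^ (wt m + wt m')) _ (size-cube-∩ m m' (dis ∘ suc))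
size-cube-∩ (true ∷ m) (true ∷ m') dis with () ← dis zero

sens-cube : ∀ {n} b (m : Vec Bool n) v → cube b m v ≡ true → sens (cube b m) v ≡ wt m
sens-cube b [] [] p = refl
sens-cube b (false ∷ m) (x ∷ v) p rewrite p = sens-cube b m v p
sens-cube false (true ∷ m) (false ∷ v) p = cong suc (sens-cube false m v p)
sens-cube true (true ∷ m) (true ∷ v) p = cong suc (sens-cube true m v p)

cube-constant : ∀ {n} b (m : Vec Bool n) → cube b m (replicate n b) ≡ true
cube-constant b [] = refl
cube-constant b (false ∷ m) = cube-constant b m
cube-constant false (true ∷ m) = cube-constant false m
cube-constant true (true ∷ m) = cube-constant true m

cube-full : ∀ {n} b (m : Vec Bool n) v → wt m ≡ 0 → cube b m v ≡ true
cube-full b [] [] p = refl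
cube-full b (false ∷ m) (x ∷ v) p = cube-full b m v p

cube-true⇒wt≤ : ∀ {n} (m : Vec Bool n) v → cube true m v ≡ true → wt m ≤ wt v
cube-true⇒wt≤ [] [] p = z≤n
cube-true⇒wt≤ (false ∷ m) (x ∷ v) p = ≤-trans (cube-true⇒wt≤ m v p) (m≤n+m (wt v) (𝟙 x))
cube-true⇒wt≤ (true ∷ m) (true ∷ v) p = s≤s (cube-true⇒wt≤ m v p)

wt-replicate-false : ∀ n → wt (replicate n false) ≡ 0
wt-replicate-false zero = refl
wt-replicate-false (suc n) = wt-replicate-false n

wt-replicate-true : ∀ n → wt (replicate n true) ≡ n
wt-replicate-true zero = refl
wt-replicate-true (suc n) = cong suc (wt-replicate-true n)

wt-++ : ∀ {n n'} (m : Vec Bool n) (m' : Vec Bool n') → wt (m ++ m') ≡ wt m + wt m'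
wt-++ [] m' = refl
wt-++ (b ∷ m) m' = trans (cong (λ x → 𝟙 b + x) (wt-++ m m')) (sym (+-assoc (𝟙 b) (wt m) (wt m')))

wt-unit : ∀ {n} (i : Fin n) → wt (flipAt (replicate n false) i) ≡ 1
wt-unit {suc n} zero = cong suc (wt-replicate-false n)
wt-unit {suc n} (suc i) = wt-unit i

-- By `unit`, every neighbour of the zero vertex in the second cube is already in the first. The
-- zero vertex then has degree exactly `d`, so the minimum degree is not larger.
module TwoCubes {n} d k (d+k≡n : d + k ≡ n) (m m' : Vec Bool n) (wt-m : wt m ≡ k) (wt-m' : wt m' ≡ k)
  (unit : ∀ i → cube true m' (flipAt (replicate n false) i) ≡ true → cube false m (flipAt (replicate n false) i) ≡ true)
  where

  A B A∪B A∩B : VertexSet n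
  A = cube false m
  B = cube true m'
  A∪B v = A v ∨ B v
  A∩B v = A v ∧ B v

  size-A∪B : size A∪B + size A∩B ≡ 2 ^ suc d
  size-A∪B = begin
    size A∪B + size A∩B                   ≡⟨ ∑ᵛ-+ (𝟙 ∘ A∪B) (𝟙 ∘ A∩B) ⟨
    ∑ᵛ (λ v → 𝟙 (A∪B v) + 𝟙 (A∩B v))      ≡⟨ ∑ᵛ-cong (λ v → inclusion-exclusion (A v) (B v)) ⟩
    ∑ᵛ (λ v → 𝟙 (A v) + 𝟙 (B v))          ≡⟨ ∑ᵛ-+ (𝟙 ∘ A) (𝟙 ∘ B) ⟩
    size A + size B                       ≡⟨ cong₂ _+_ (size≡2^d false m wt-m) (size≡2^d true m' wt-m') ⟩
    2 ^ d + 2 ^ d                         ≡⟨ cong (λ x → 2 ^ d + x) (+-identityʳ (2 ^ d)) ⟨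
    2 ^ suc d                             ∎
    where
    open ≡-Reasoning
    inclusion-exclusion : ∀ a b → 𝟙 (a ∨ b) + 𝟙 (a ∧ b) ≡ 𝟙 a + 𝟙 b
    inclusion-exclusion true true = refl
    inclusion-exclusion true false = refl
    inclusion-exclusion false true = refl
    inclusion-exclusion false false = refl
    size≡2^d : ∀ b (m : Vec Bool n) → wt m ≡ k → size (cube b m) ≡ 2 ^ d
    size≡2^d b m refl = *-cancelʳ-≡ (size (cube b m)) (2 ^ d) (2 ^ k) {{m^n≢0 2 k}} (begin
      size (cube b m) * 2 ^ k   ≡⟨ size-cube b m ⟩
      2 ^ n                     ≡⟨ cong (2 ^_) d+k≡n ⟨
      2 ^ (d + k)               ≡⟨ ^-distribˡ-+-* 2 d k ⟩
      2 ^ d * 2 ^ k             ∎)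

  zeros∈A : A (replicate n false) ≡ true
  zeros∈A = cube-constant false m

  zeros∈A∪B : A∪B (replicate n false) ≡ true
  zeros∈A∪B = cong (_∨ B (replicate n false)) zeros∈A

  -- The zero vertex in `A` and the all-one vertex in `B` attain all literals.
  irreducible : Irreducible A∪B
  irreducible i false = replicate n false , zeros∈A∪B , lookup-replicate i false
  irreducible i true = replicate n true ,
    trans (cong (A (replicate n true) ∨_) (cube-constant true m')) (∨-zeroʳ (A (replicate n true))) , lookup-replicate i true

  sens≤ : SensBounded k A∪B
  sens≤ v p with A v in a
  ... | true = ≤-trans (sens-anti {S = A} {A∪B} v λ i q → cong (_∨ B (flipAt v i)) q)
                 (≤-reflexive (trans (sens-cube false m v a) wt-m))
  ... | false = ≤-trans (sens-anti {S = B} {A∪B} v λ i q → trans (cong (A (flipAt v i) ∨_) q) (∨-zeroʳ (A (flipAt v i))))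
                  (≤-reflexive (trans (sens-cube true m' v p) wt-m'))

  sens-zeros : sens A∪B (replicate n false) ≡ k
  sens-zeros = ≤-antisym (sens≤ _ zeros∈A∪B) (begin
    k                               ≡⟨ trans (sens-cube false m _ zeros∈A) wt-m ⟨
    sens A (replicate n false)      ≤⟨ sens-anti {S = A∪B} {A} _ back ⟩
    sens A∪B (replicate n false)    ∎)
    where
    open ≤-Reasoning
    back : ∀ i → A∪B (flipAt (replicate n false) i) ≡ true → A (flipAt (replicate n false) i) ≡ true
    back i p with A (flipAt (replicate n false) i) in a
    ... | true = refl
    ... | false = trans (sym a) (unit i p)

  admissible : Admissible n d A∪B
  admissible = (replicate n false , zeros∈A∪B) , irreducible ,
    (λ v p → +-cancelʳ-≤ k d (degree A∪B v) (begin
      d + k                          ≡⟨ d+k≡n ⟩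
      n                              ≡⟨ degree+sens A∪B v ⟨
      degree A∪B v + sens A∪B v      ≤⟨ +-monoʳ-≤ (degree A∪B v) (sens≤ v p) ⟩
      degree A∪B v + k               ∎)) ,
    replicate n false , zeros∈A∪B ,
    +-cancelʳ-≡ k (degree A∪B (replicate n false)) d
      (trans (cong (λ x → degree A∪B (replicate n false) + x) (sym sens-zeros)) (trans (degree+sens A∪B (replicate n false)) (sym d+k≡n)))
    where open ≤-Reasoning

-- Vertices of the second cube have weight at least 2, neighbours of the zero vertex have weight 1.
unit-of-wt≥2 : ∀ {n} (m m' : Vec Bool n) → 2 ≤ wt m' → ∀ i →
  cube true m' (flipAt (replicate n false) i) ≡ true → cube false m (flipAt (replicate n false) i) ≡ true
unit-of-wt≥2 m m' 2≤wt i p = contradiction (≤-trans 2≤wt (≤-trans (cube-true⇒wt≤ m' _ p) (≤-reflexive (wt-unit i)))) λ { (s≤s ()) }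

two-cubes-k≤d : ∀ k e → ∃ λ (S : VertexSet (k + (k + e))) → Admissible (k + (k + e)) (k + e) S × size S + 2 ^ e ≡ 2 ^ suc (k + e)
two-cubes-k≤d k e = A∪B , admissible , trans (cong (λ x → size A∪B + x) (sym size-A∩B)) size-A∪B
  where
  -- Two disjoint blocks of k coordinates fit because n = 2k + e; the intersection has dimension e =
  -- 2d - n, whence the term 2^(2d-n).
  mask mask' : ∀ k → Vec Bool (k + (k + e))
  mask k = replicate k true ++ replicate (k + e) false
  mask' k = replicate k false ++ (replicate k true ++ replicate e false)
  wt-mask : wt (mask k) ≡ k
  wt-mask = trans (wt-++ (replicate k true) (replicate (k + e) false))
    (trans (cong₂ _+_ (wt-replicate-true k) (wt-replicate-false (k + e))) (+-identityʳ k))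
  wt-mask' : wt (mask' k) ≡ k
  wt-mask' = trans (wt-++ (replicate k false) _) (trans (cong₂ _+_ (wt-replicate-false k)
    (trans (wt-++ (replicate k true) (replicate e false)) (cong₂ _+_ (wt-replicate-true k) (wt-replicate-false e)))) (+-identityʳ k))
  disjoint : ∀ k {l} (w : Vec Bool l) → Disjoint (replicate k true ++ replicate l false) (replicate k false ++ w)
  disjoint zero {l} w i = cong (_∧ lookup w i) (lookup-replicate i false)
  disjoint (suc k) w zero = refl
  disjoint (suc k) w (suc i) = disjoint k w i
  unit : ∀ k → wt (mask k) ≡ k → wt (mask' k) ≡ k → ∀ i →
    cube true (mask' k) (flipAt (replicate _ false) i) ≡ true → cube false (mask k) (flipAt (replicate _ false) i) ≡ true
  -- For k = 0 the first cube is everything. For k = 1 it is x_0 = 0 and contains all unit vectors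
  -- but the first, which the second cube x_1 = 1 misses.
  unit zero wt-m _ i _ = cube-full false (mask 0) _ wt-m
  unit (suc zero) _ _ zero ()
  unit (suc zero) _ _ (suc i) _ = cube-full false (replicate (suc e) false) (flipAt (replicate (suc e) false) i) (wt-replicate-false (suc e))
  unit (suc (suc k)) _ wt-m' i = unit-of-wt≥2 (mask (2 + k)) (mask' (2 + k)) (≤-trans (s≤s (s≤s z≤n)) (≤-reflexive (sym wt-m'))) i
  open TwoCubes (k + e) k (+-comm (k + e) k) (mask k) (mask' k) wt-mask wt-mask' (unit k wt-mask wt-mask')
  size-A∩B : size A∩B ≡ 2 ^ e
  size-A∩B = *-cancelʳ-≡ (size A∩B) (2 ^ e) (2 ^ (k + k)) {{m^n≢0 2 (k + k)}} (begin
    size A∩B * 2 ^ (k + k)                      ≡⟨ cong₂ (λ a b → size A∩B * 2 ^ (a + b)) wt-mask wt-mask' ⟨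
    size A∩B * 2 ^ (wt (mask k) + wt (mask' k)) ≡⟨ size-cube-∩ (mask k) (mask' k) (disjoint k (replicate k true ++ replicate e false)) ⟩
    2 ^ (k + (k + e))                           ≡⟨ cong (2 ^_) (regroup k e) ⟩
    2 ^ (e + (k + k))                           ≡⟨ ^-distribˡ-+-* 2 e (k + k) ⟩
    2 ^ e * 2 ^ (k + k)                         ∎)
    where
    open ≡-Reasoning
    regroup : ∀ k e → k + (k + e) ≡ e + (k + k)
    regroup = solve-∀

two-cubes-d<k : ∀ d e → 2 ≤ d + suc e → ∃ λ (S : VertexSet (d + (d + suc e))) → Admissible (d + (d + suc e)) d S × size S ≤ 2 ^ suc d
two-cubes-d<k d e 2≤k = A∪B , admissible , ≤-trans (m≤m+n (size A∪B) (size A∩B)) (≤-reflexive size-A∪B)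
  where
  k = d + suc e
  -- The masks cover all n coordinates and overlap in the last 1 + e = k - d of them, the least
  -- possible overlap.
  mask mask' : Vec Bool (d + k)
  mask = replicate d false ++ replicate k true
  mask' = replicate d true ++ (replicate d false ++ replicate (suc e) true)
  wt-mask : wt mask ≡ k
  wt-mask = trans (wt-++ (replicate d false) (replicate k true)) (cong₂ _+_ (wt-replicate-false d) (wt-replicate-true k))
  wt-mask' : wt mask' ≡ k
  wt-mask' = trans (wt-++ (replicate d true) _) (cong₂ _+_ (wt-replicate-true d)
    (trans (wt-++ (replicate d false) (replicate (suc e) true)) (cong₂ _+_ (wt-replicate-false d) (wt-replicate-true (suc e)))))
  open TwoCubes d k refl mask mask' wt-mask wt-mask' (unit-of-wt≥2 mask mask' (≤-trans 2≤k (≤-reflexive (sym wt-mask'))))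

-- The bound and its attainment

admissible⇒d≤n : ∀ {n d} {S : VertexSet n} → Admissible n d S → d ≤ n
admissible⇒d≤n {S = S} (_ , _ , _ , v , _ , refl) = subst (degree S v ≤_) (degree+sens S v) (m≤m+n _ _)

-- Irreducibility forces `S` to be all of Q_1, where every degree is 1.
not-admissible-1-0 : ∀ {S : VertexSet 1} → ¬ Admissible 1 0 S
not-admissible-1-0 {S} (_ , irr , _ , v , _ , deg) = isolated v deg
  where
  full : ∀ b → S (b ∷ []) ≡ true
  full b with irr zero b
  ... | (.b ∷ []) , s , refl = s
  isolated : ∀ v → degree S v ≢ 0
  isolated (b ∷ []) deg rewrite full (not b) with () ← deg

-- `SizeBound` times D = 2^d, with the common factor K = 2^(n-d) cancelled; here 2^n = D K and
-- 2^(2d) = D D.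
admissible⇒size≥ : ∀ {n d} {S : VertexSet n} → Admissible n d S → 2 ^ suc d * 2 ^ n ≤ size S * 2 ^ n + 2 ^ (2 * d)
admissible⇒size≥ {n} {d} {S} adm@(ne , irr , deg≥ , _) = *-cancelʳ-≤ _ _ K {{m^n≢0 2 k}} (begin
  2 * D * 2 ^ n * K                      ≡⟨ cong (λ x → 2 * D * x * K) 2^n≡ ⟩
  2 * D * (D * K) * K                    ≡⟨ regroup₁ D K ⟩
  D * (D * K * (2 * K))                  ≡⟨ cong (λ x → D * (x * (2 * K))) 2^n≡ ⟨
  D * (2 ^ n * 2 ^ suc k)                ≤⟨ *-monoʳ-≤ D (lowerBound k S ne irr sens≤k) ⟩
  D * (size S * 4 ^ k + 2 ^ n)           ≡⟨ cong₂ (λ x y → D * (size S * x + y)) (4^k≡2^k*2^k k) 2^n≡ ⟩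
  D * (size S * (K * K) + D * K)         ≡⟨ regroup₂ (size S) D K ⟩
  (size S * (D * K) + D * D) * K         ≡⟨ cong₂ (λ x y → (size S * x + y) * K) 2^n≡ 2^2d≡ ⟨
  (size S * 2 ^ n + 2 ^ (2 * d)) * K     ∎)
  where
  open ≤-Reasoning
  k = n ∸ d
  D = 2 ^ d
  K = 2 ^ k
  d+k≡n : d + k ≡ n
  d+k≡n = m+[n∸m]≡n (admissible⇒d≤n adm)
  2^n≡ : 2 ^ n ≡ D * K
  2^n≡ = trans (cong (2 ^_) (sym d+k≡n)) (^-distribˡ-+-* 2 d k)
  2^2d≡ : 2 ^ (2 * d) ≡ D * D
  2^2d≡ = trans (cong (λ x → 2 ^ (d + x)) (+-identityʳ d)) (^-distribˡ-+-* 2 d d)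
  regroup₁ : ∀ D K → 2 * D * (D * K) * K ≡ D * (D * K * (2 * K))
  regroup₁ = solve-∀
  regroup₂ : ∀ s D K → D * (s * (K * K) + D * K) ≡ (s * (D * K) + D * D) * K
  regroup₂ = solve-∀
  sens≤k : SensBounded k S
  sens≤k v p = +-cancelˡ-≤ d _ _ (begin
    d + sens S v              ≤⟨ +-monoˡ-≤ (sens S v) (deg≥ v p) ⟩
    degree S v + sens S v     ≡⟨ degree+sens S v ⟩
    n                         ≡⟨ d+k≡n ⟨
    d + k                     ∎)

lower : ∀ {n d} {S : VertexSet n} → Admissible n d S → bound n d ℤ.≤ + card S
lower {n} {d} {S} adm rewrite card≡size S = Bound.bound-≤ n d (size S) (admissible⇒size≥ adm)

-- The hypothesis says |S| - 1 < 2^(d+1) - 2^(2d-n), so |S| is at most the ceiling.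
attained : ∀ {n d} {S : VertexSet n} → Admissible n d S →
  size S * 2 ^ n + 2 ^ (2 * d) < 2 ^ suc d * 2 ^ n + 2 ^ n → + card S ≡ bound n d
attained {n} {d} {S} adm h = ℤ.≤-antisym
  (subst (λ s → + s ℤ.≤ bound n d) (sym (card≡size S)) (Bound.≤-bound n d (size S) h)) (lower adm)

Optimal : ℕ → ℕ → Set
Optimal n d = ∃ λ (S : VertexSet n) → Admissible n d S × + card S ≡ bound n d

optimal-when-k≤d : ∀ k e → Optimal (k + (k + e)) (k + e)
optimal-when-k≤d k e with two-cubes-k≤d k e
... | S , adm , sz = S , adm , attained adm (begin-strict
  size S * 2 ^ n + 2 ^ (2 * d)         ≡⟨ cong (λ x → size S * 2 ^ n + x) (trans (cong (2 ^_) (regroup k e)) (^-distribˡ-+-* 2 e n)) ⟩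
  size S * 2 ^ n + 2 ^ e * 2 ^ n       ≡⟨ *-distribʳ-+ (2 ^ n) (size S) (2 ^ e) ⟨
  (size S + 2 ^ e) * 2 ^ n             ≡⟨ cong (_* 2 ^ n) sz ⟩
  2 ^ suc d * 2 ^ n                    <⟨ m<m+n _ (m^n>0 2 n) ⟩
  2 ^ suc d * 2 ^ n + 2 ^ n            ∎)
  where
  open ≤-Reasoning
  n = k + (k + e)
  d = k + e
  regroup : ∀ k e → 2 * (k + e) ≡ e + (k + (k + e))
  regroup = solve-∀

optimal-when-d<k : ∀ d e → 2 ≤ d + suc e → Optimal (d + (d + suc e)) d
optimal-when-d<k d e 2≤k with two-cubes-d<k d e 2≤k
... | S , adm , sz = S , adm , attained adm
  -- As 2d < n, the correction 2^(2d-n) is below 1, and |S| ≤ 2^(d+1) is good enough.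
  (+-mono-≤-< (*-monoˡ-≤ (2 ^ (d + (d + suc e))) sz) (^-monoʳ-< 2 (s≤s (s≤s z≤n)) 2d<n))
  where
  2d<n : 2 * d < d + (d + suc e)
  2d<n = +-monoʳ-< d (+-monoʳ-< d (s≤s z≤n))

optimal : ∀ n d → (∃ λ (S : VertexSet n) → Admissible n d S) → Optimal n d
optimal n d (S₀ , adm₀) = cases (≤-<-connex k d)
  where
  k = n ∸ d
  d+k≡n : d + k ≡ n
  d+k≡n = m+[n∸m]≡n (admissible⇒d≤n adm₀)
  narrow : ∀ d' e → d' ≡ d → d' + (d' + suc e) ≡ n → Optimal n d
  -- d = 0 and k = 1 is the only case with d < k and k < 2; it means n = 1, where no admissible set
  -- exists.
  narrow zero zero refl refl = ⊥-elim (not-admissible-1-0 adm₀)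
  narrow zero (suc e) refl refl = optimal-when-d<k 0 (suc e) (s≤s (s≤s z≤n))
  narrow (suc d) e refl refl = optimal-when-d<k (suc d) e (s≤s (≤-trans (s≤s z≤n) (m≤n+m (suc e) d)))
  cases : k ≤ d ⊎ d < k → Optimal n d
  cases (inj₁ k≤d) = subst₂ Optimal (trans (cong (λ x → k + x) k+e≡d) (trans (+-comm k d) d+k≡n)) k+e≡d (optimal-when-k≤d k (d ∸ k))
    where
    k+e≡d : k + (d ∸ k) ≡ d
    k+e≡d = m+[n∸m]≡n k≤d
  cases (inj₂ d<k) = narrow d (k ∸ suc d) refl
    (trans (cong (λ x → d + x) (trans (+-suc d (k ∸ suc d)) (m+[n∸m]≡n d<k))) d+k≡n)

theorem2 : (n d : ℕ) → n ≥ 1 →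
    ((S : VertexSet n) → Admissible n d S → bound n d ℤ.≤ + card S)
    × ((∃ λ (S : VertexSet n) → Admissible n d S) →
    ∃ λ (S : VertexSet n) → Admissible n d S × + card S ≡ bound n d)
theorem2 n d _ = (λ S → lower) , optimal n d
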